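{- Let $\mu$ be a composition of $n$, $\tau\in\mathcal{I}_\mu$, and let $\mathbf{a}=(a_1,\dots,a_p)$ be a word such that $(\mathbf{a},m)$ is nearly $\mu$--reduced for $\tau$. Then there exists a unique $k\neq m$ such that $(\mathbf{a},k)$ is nearly $\mu$--reduced for $\tau$.
   Context: Permutations are in one-line notation; $\mathrm{std}$ is standardization. $\ell$ is Coxeter length, $s_i=(i,i{+}1)$, $e$ the identity. The 0--Hecke product is $w\circ s_i=ws_i$ if $\ell(ws_i)>\ell(w)$, else $w$ (similarly on the left). For a composition $\mu=(\mu_1,\dots,\mu_k)$ of $n$, $\pi\in S_n$ and $m_r=\mu_1+\dots+\mu_{r-1}$, the $r$th block is $B_r=\pi(m_r{+}1)\cdots\pi(m_r{+}\mu_r)$; $\pi$ is a $\mu$--involution ($\pi\in\mathcal{I}_\mu$) if each $\mathrm{std}(B_r)$ is an involution. For $\pi\in\mathcal{I}_\mu$, $i\in[n-1]$: if values $i,i{+}1$ are in different blocks, $\pi\circ_\mu s_i=s_i\circ\pi$; if in the same block $B$, replace $B$ by the word on the same values with standardization $s_r\circ\mathrm{std}(B)\circ s_r$, where $i$ is the $r$th smallest value of $B$. This extends to a right action of the 0--Hecke monoid. A word $\mathbf{a}=(a_1,\dots,a_p)$ is a $\mu$--word for $e\circ_\mu s_{a_1}\circ_\mu\cdots\circ_\mu s_{a_p}$; it is $\mu$--reduced if no shorter $\mu$--word gives the same element. $\mathcal{R}_\mu(\pi)$ is the set of $\mu$--reduced $\mu$--words for $\pi$. $(\mathbf{a},i)$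 is nearly $\mu$--reduced for $\tau$ if $\mathbf{a}$ is not $\mu$--reduced and $(a_1,\dots,\widehat{a_i},\dots,a_p)\in\mathcal{R}_\mu(\tau)$. -}

module Defs where

open import Data.Nat using (ℕ; zero; suc; _+_; _∸_; _≤_; _<_)
open import Data.Nat.Properties using (_≟_; _<?_)
open import Data.Bool using (Bool; true; false; if_then_else_; _∧_)
open import Data.List using (List; []; _∷_; map; filter; length; upTo; take; drop; concat; foldl; removeAt)
open import Data.Nat.ListAction using (sum)
open import Data.Bool.ListAction using (any)
open import Data.List.Relation.Unary.All using (All)
open import Data.List.Relation.Binary.Permutation.Propositional using (_↭_)
open import Data.Fin using (Fin)
open import Data.Product using (_×_; ∃)
open import Relation.Nullary using (¬_)
open import Relation.Nullary.Decidable using (⌊_⌋)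
open import Relation.Binary.PropositionalEquality using (_≡_; _≢_)

-- Permutations of [n] are lists in one-line notation with values 1..n.

-- 1-indexed lookup (default 0 outside the range)
at : List ℕ → ℕ → ℕ
at [] _ = 0
at (x ∷ xs) zero = 0
at (x ∷ xs) (suc zero) = x
at (x ∷ xs) (suc (suc k)) = at xs (suc k)

idPerm : ℕ → List ℕ
idPerm n = map suc (upTo n)

IsPerm : ℕ → List ℕ → Set
IsPerm n w = w ↭ idPerm n

IsComposition : ℕ → List ℕ → Set
IsComposition n μ = All (λ k → 0 < k) μ × sum μ ≡ n

-- Coxeter length = number of inversions
len : List ℕ → ℕ
len [] = 0
len (x ∷ xs) = length (filter (λ y → y <? x) xs) + len xs

-- w s_i : swap positions i, i+1 (1-indexed)
swapPos : ℕ → List ℕ → List ℕ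
swapPos (suc zero) (x ∷ y ∷ xs) = y ∷ x ∷ xs
swapPos (suc (suc i)) (x ∷ xs) = x ∷ swapPos (suc i) xs
swapPos _ xs = xs

-- s_i w : swap values i, i+1
swapVal : ℕ → List ℕ → List ℕ
swapVal i = map (λ x → if ⌊ x ≟ i ⌋ then suc i else (if ⌊ x ≟ suc i ⌋ then i else x))

heckeR : List ℕ → ℕ → List ℕ
heckeR w i = if ⌊ len w <? len (swapPos i w) ⌋ then swapPos i w else w

heckeL : ℕ → List ℕ → List ℕ
heckeL i w = if ⌊ len w <? len (swapVal i w) ⌋ then swapVal i w else w

rank : List ℕ → ℕ → ℕ
rank B x = suc (length (filter (λ y → y <? x) B))

std : List ℕ → List ℕ
std B = map (rank B) B

valOfRank : List ℕ → ℕ → ℕ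
valOfRank B j = at (filter (λ x → rank B x ≟ j) B) 1

blocks : List ℕ → List ℕ → List (List ℕ)
blocks [] π = []
blocks (k ∷ μ) π = take k π ∷ blocks μ (drop k π)

IsInvolution : List ℕ → Set
IsInvolution σ = ∀ j → 1 ≤ j → j ≤ length σ → at σ (at σ j) ≡ j

IsMuInvolution : ℕ → List ℕ → List ℕ → Set
IsMuInvolution n μ π = IsPerm n π × All (λ B → IsInvolution (std B)) (blocks μ π)

mem : ℕ → List ℕ → Bool
mem v B = any (λ x → ⌊ x ≟ v ⌋) B

-- same values as B, standardization s_r ∘ std(B) ∘ s_r, r = rank of i in B
newBlock : ℕ → List ℕ → List ℕ
newBlock i B = map (valOfRank B) (heckeR (heckeL r (std B)) r)
  where r = rank B i

step : List ℕ → List ℕ → ℕ → List ℕ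
step μ π i =
  if any (λ B → mem i B ∧ mem (suc i) B) (blocks μ π)
  then concat (map (λ B → if mem i B then newBlock i B else B) (blocks μ π))
  else heckeL i π

act : ℕ → List ℕ → List ℕ → List ℕ
act n μ a = foldl (step μ) (idPerm n) a

IsWord : ℕ → List ℕ → Set
IsWord n a = All (λ i → 1 ≤ i × i < n) a

IsMuReduced : ℕ → List ℕ → List ℕ → Set
IsMuReduced n μ a =
  IsWord n a × (∀ b → IsWord n b → length b < length a → act n μ b ≢ act n μ a)

InRμ : ℕ → List ℕ → List ℕ → List ℕ → Set
InRμ n μ τ a = IsMuReduced n μ a × act n μ a ≡ τ

NearlyMuReduced : ℕ → List ℕ → List ℕ → (a : List ℕ) → Fin (length a) → Set
NearlyMuReduced n μ τ a i = ¬ IsMuReduced n μ a × InRμ n μ τ (removeAt a i)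

{-# OPTIONS --safe #-}
-- Call a word ascending when each of its letters changes the element it is applied to; ascending
-- words turn out to be the reduced ones. For a word w let L w be the set of elements reached by
-- subwords of w. As in Matsumoto's theorem, an induction on length shows that the length and the
-- set L of an ascending word depend only on the element reached, by comparing two descents s , t
-- of that element through its orbit under ⟨s , t⟩. Collapsed orbits, where the words s t … and
-- t s … meet early, are avoided by detouring through a third descent, or else start at e.
--
-- Let f be the first letter of a making the prefix non-reduced, q the word before it. As f is a
-- descent of the element of q, that element has an ascending word ending in f, with the same L:
-- hence deleting some letter of q gives the element below it (exchange), and conversely if f
-- ascends after deleting a letter of q then it leads to the element of q (lifting). So the nearly
-- reduced positions are that of f and exactly one position in q.
module Submission where

open import Defs
open import Data.Bool using (Bool; true; false; if_then_else_; _∧_; _∨_)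
open import Data.Bool.ListAction using (any)
open import Data.Bool.Properties using (∨-zeroʳ; ∧-zeroʳ)
open import Data.Empty using (⊥; ⊥-elim)
open import Data.Fin using (Fin; toℕ)
open import Data.Fin.Properties using (toℕ-injective)
open import Data.List using (List; []; _∷_; map; filter; length; applyUpTo; take; drop; concat; foldl; foldr; removeAt; reverse; _++_)
open import Data.List.Membership.Propositional using (_∈_; _∉_)
open import Data.List.Membership.Propositional.Properties using (∈-++⁺ˡ; ∈-++⁺ʳ; ∈-++⁻; ∈-map⁺; ∈-map⁻; ∈-filter⁺; ∈-filter⁻)
open import Data.List.Membership.Propositional.Properties.WithK using (unique∧set⇒bag)
open import Data.List.Properties hiding (sum-++)
open import Data.List.Relation.Binary.BagAndSetEquality using (∼bag⇒↭)
open import Data.List.Relation.Binary.Permutation.Propositional using (_↭_)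
open import Data.List.Relation.Binary.Permutation.Propositional.Properties using (filter-↭; ↭-length)
open import Data.List.Relation.Unary.All as All using (All; []; _∷_)
open import Data.List.Relation.Unary.AllPairs as AllPairs using (AllPairs; []; _∷_)
import Data.List.Relation.Unary.AllPairs.Properties as AllPairsP
open import Data.List.Relation.Unary.Any using (here; there)
open import Data.List.Relation.Unary.Unique.Propositional using (Unique)
import Data.List.Relation.Unary.Unique.Propositional.Properties as UniqueP
open import Data.Nat using (ℕ; zero; suc; _+_; _∸_; _≤_; _<_; z≤n; s≤s)
open import Data.Nat.Induction using (<-rec)
open import Data.Nat.ListAction using (sum)
open import Data.Nat.Properties
open import Data.Product using (_×_; ∃; _,_; proj₁; proj₂; uncurry)
open import Data.Sum using (_⊎_; inj₁; inj₂)
open import Data.Unit using (⊤; tt)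
open import Function using (_∘_; flip)
open import Function.Bundles using (mk⇔)
open import Relation.Binary using (IsEquivalence)
open import Relation.Binary.Definitions using (tri<; tri≈; tri>)
open import Relation.Binary.PropositionalEquality using (_≡_; _≢_; refl; sym; trans; cong; cong₂; subst; subst₂; module ≡-Reasoning)
open import Relation.Nullary using (¬_; Dec; yes; no)
open import Relation.Nullary.Decidable using (⌊_⌋; _×-dec_; _⊎-dec_)
open import Relation.Unary using (Decidable)

-- The obstacle is that an orbit of two letters may be shorter than in a Coxeter group. A relation
-- read off a collapsed orbit is known only at its bottom element, not at the elements reached by
-- subwords of the word below, so it does not transport `L`; the genuine commutation and braid
-- relations hold at every element reached by a word, and do. Over `e` the word below is empty, so a
-- collapse there is harmless; otherwise a third descent is available at the top. The set `L` is
-- carried along because equal lengths say nothing about deletions: exchange reads off from `L` that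
-- the element below arises by omitting one letter, and lifting uses the same equality of sets in
-- the other direction. The combinatorics of μ-involutions enters only through orbits of two
-- letters; everything else is done for an abstract action. Its letters range over all of ℕ, so
-- states are functions on ℕ, and the bound n returns only when states are decoded into lists.

Near Far : ℕ → ℕ → Set
Near s t = (suc s ≡ t) ⊎ (suc t ≡ s)
Far s t = s ≢ t × suc s ≢ t × suc t ≢ s

near-sym : ∀ {s t} → Near s t → Near t s
near-sym (inj₁ p) = inj₂ p
near-sym (inj₂ p) = inj₁ p

far-sym : ∀ {s t} → Far s t → Far t s
far-sym (p , q , r) = (λ e → p (sym e)) , r , q

near-or-far : ∀ {s t} → s ≢ t → Near s t ⊎ Far s t
near-or-far {s} {t} s≢t with suc s ≟ t | suc t ≟ s
... | yes p | _ = inj₁ (inj₁ p)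
... | no _ | yes q = inj₁ (inj₂ q)
... | no p | no q = inj₂ (s≢t , p , q)

-- Actions described by their orbits under two letters.

record LocalAction : Set₁ where
  infix 4 _≈_
  field
    X : Set
    _≈_ : X → X → Set
    ≈-equiv : IsEquivalence _≈_
    e : X
    U : ℕ → X → X
    Asc : ℕ → X → Set
    asc? : ∀ s x → Dec (Asc s x)
    -- Marks the tops of the collapsed orbits of ⟨s , t⟩, those where the two alternating words
    -- meet before reaching the length of the longest element of ⟨s , t⟩.
    Bad : ℕ → ℕ → X → Set
    U-cong : ∀ s {x y} → x ≈ y → U s x ≈ U s y
    Asc-resp : ∀ s {x y} → x ≈ y → Asc s x → Asc s y
    Bad-resp : ∀ {s t x y} → x ≈ y → Bad s t x → Bad s t y
    U-desc : ∀ s {x} → ¬ Asc s x → U s x ≈ x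
    U-asc : ∀ s {x} → Asc s x → ¬ Asc s (U s x)
    U-inj : ∀ s {x y} → Asc s x → Asc s y → U s x ≈ U s y → x ≈ y
    Asc-e : ∀ s → Asc s e
    Bad-sym : ∀ {s t x} → Bad s t x → Bad t s x
    Bad-unique : ∀ {s t u x} → Bad s t x → Bad s u x → u ≡ t
    -- Here z is the bottom of the orbit. The collapsed orbit has height one, and its third descent
    -- may be created by the collapse itself, so it has to be supplied.
    far : ∀ {s t} z → Far s t → Asc s z → Asc t z →
      (Asc t (U s z) × U t (U s z) ≈ U s (U t z)) ⊎
      (U s z ≈ U t z × Bad s t (U s z) × ∃ λ u → u ≢ s × u ≢ t × ¬ Asc u (U s z))
    -- The collapsed orbit has height two. Descents of z survive to its top, so any descent of z
    -- serves as the third one.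
    near : ∀ {s t} z → Near s t → Asc s z → Asc t z →
      Asc t (U s z) ×
      ((Asc s (U t (U s z)) × U s (U t (U s z)) ≈ U t (U s (U t z))) ⊎
       (U t (U s z) ≈ U s (U t z) × Bad s t (U t (U s z)) ×
        (∀ u → ¬ Asc u z → ¬ Asc u (U t (U s z)))))

-- Exchange, lifting and deletion for ascending words.

module Exchange (A : LocalAction) where
  open LocalAction A
  open IsEquivalence ≈-equiv renaming (refl to ≈-refl; sym to ≈-sym; trans to ≈-trans)

  infixr 5 _⊙_
  _⊙_ : ∀ {x y z} → x ≈ y → y ≈ z → x ≈ z
  _⊙_ = ≈-trans

  Desc-resp : ∀ s {x y} → x ≈ y → ¬ Asc s x → ¬ Asc s y
  Desc-resp s p d a = d (Asc-resp s (≈-sym p) a)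

  ¬Asc-U : ∀ s x → ¬ Asc s (U s x)
  ¬Asc-U s x with asc? s x
  ... | yes a = U-asc s a
  ... | no d = Desc-resp s (≈-sym (U-desc s d)) d

  U-idem : ∀ s x → U s (U s x) ≈ U s x
  U-idem s x = U-desc s (¬Asc-U s x)

  -- Words are read right to left: the head is the letter applied last.
  E : List ℕ → X
  E [] = e
  E (s ∷ w) = U s (E w)

  Ascending : List ℕ → Set
  Ascending [] = ⊤
  Ascending (s ∷ w) = Ascending w × Asc s (E w)

  prune : ∀ w → Ascending w ⊎ ∃ λ c → Ascending c × length c < length w × E c ≈ E w
  prune [] = inj₁ tt
  prune (s ∷ w) with prune w | asc? s (E w)
  ... | inj₁ a | yes p = inj₁ (a , p)
  ... | inj₁ a | no d = inj₂ (w , a , n<1+n _ , ≈-sym (U-desc s d))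
  ... | inj₂ (c , a , l , q) | _ with asc? s (E c)
  ...   | yes p = inj₂ (s ∷ c , (a , p) , s≤s l , U-cong s q)
  ...   | no d = inj₂ (c , a , m≤n⇒m≤1+n l , ≈-sym (U-desc s d) ⊙ U-cong s q)

  prune-≤ : ∀ w → ∃ λ c → Ascending c × length c ≤ length w × E c ≈ E w
  prune-≤ w with prune w
  ... | inj₁ a = w , a , ≤-refl , ≈-refl
  ... | inj₂ (c , a , l , q) = c , a , <⇒≤ l , q

  L : List ℕ → X → Set
  L [] x = x ≈ e
  L (s ∷ w) x = L w x ⊎ ∃ λ y → L w y × x ≈ U s y

  _≋_ : List ℕ → List ℕ → Set
  v ≋ w = (∀ {x} → L v x → L w x) × (∀ {x} → L w x → L v x)

  ≋-refl : ∀ {w} → w ≋ w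
  ≋-refl = (λ z → z) , (λ z → z)

  ≋-sym : ∀ {v w} → v ≋ w → w ≋ v
  ≋-sym (f , g) = g , f

  ≋-trans : ∀ {u v w} → u ≋ v → v ≋ w → u ≋ w
  ≋-trans (f , g) (f′ , g′) = (λ z → f′ (f z)) , (λ z → g (g′ z))

  L-cons : ∀ s {v w} → (∀ {x} → L v x → L w x) → ∀ {x} → L (s ∷ v) x → L (s ∷ w) x
  L-cons s f (inj₁ p) = inj₁ (f p)
  L-cons s f (inj₂ (y , p , q)) = inj₂ (y , f p , q)

  ≋-cons : ∀ s {v w} → v ≋ w → (s ∷ v) ≋ (s ∷ w)
  ≋-cons s {v} {w} (f , g) = L-cons s {v} {w} f , L-cons s {w} {v} g

  L-resp : ∀ w {x y} → x ≈ y → L w x → L w y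
  L-resp [] p q = ≈-sym p ⊙ q
  L-resp (s ∷ w) p (inj₁ q) = inj₁ (L-resp w p q)
  L-resp (s ∷ w) p (inj₂ (z , q , r)) = inj₂ (z , q , (≈-sym p ⊙ r))

  L-word : ∀ w {x} → L w x → ∃ λ c → length c ≤ length w × x ≈ E c
  L-word [] p = [] , z≤n , p
  L-word (s ∷ w) (inj₁ p) with L-word w p
  ... | c , l , q = c , m≤n⇒m≤1+n l , q
  L-word (s ∷ w) (inj₂ (y , p , r)) with L-word w p
  ... | c , l , q = s ∷ c , s≤s l , (r ⊙ U-cong s q)

  L-self : ∀ w → L w (E w)
  L-self [] = ≈-refl
  L-self (s ∷ w) = inj₂ (E w , L-self w , ≈-refl)

  -- Relations are stated at a single element, because the induction establishes them only at
  -- elements reached by short words.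
  Comm Braid : X → Set
  Comm x = ∀ {s t} → Far s t → U t (U s x) ≈ U s (U t x)
  Braid x = ∀ {s t} → Near s t → U s (U t (U s x)) ≈ U t (U s (U t x))

  Comm-resp : ∀ {x y} → x ≈ y → Comm x → Comm y
  Comm-resp p c {s} {t} f =
    U-cong t (U-cong s (≈-sym p)) ⊙ c f ⊙ U-cong s (U-cong t p)

  Braid-resp : ∀ {x y} → x ≈ y → Braid x → Braid y
  Braid-resp p c {s} {t} f =
    U-cong s (U-cong t (U-cong s (≈-sym p))) ⊙ c f ⊙ U-cong t (U-cong s (U-cong t p))

  -- Only a subword using both letters needs the relation, and it needs it at an arbitrary element
  -- of `L d`, not just at `E d`.
  L-comm : ∀ {s t} → Far s t → ∀ d → (∀ {y} → L d y → Comm y) →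
           ∀ {x} → L (s ∷ t ∷ d) x → L (t ∷ s ∷ d) x
  L-comm f d c (inj₁ (inj₁ p)) = inj₁ (inj₁ p)
  L-comm f d c (inj₁ (inj₂ (y , p , q))) = inj₂ (y , inj₁ p , q)
  L-comm f d c (inj₂ (y , inj₁ p , q)) = inj₁ (inj₂ (y , p , q))
  L-comm {s} {t} f d c (inj₂ (y , inj₂ (z , p , r) , q)) =
    inj₂ (U s z , inj₂ (z , p , ≈-refl) , (q ⊙ U-cong s r ⊙ ≈-sym (c p f)))

  L-braid : ∀ {s t} → Near s t → ∀ d → (∀ {y} → L d y → Braid y) →
            ∀ {x} → L (s ∷ t ∷ s ∷ d) x → L (t ∷ s ∷ t ∷ d) x
  L-braid f d c (inj₁ (inj₁ (inj₁ p))) = inj₁ (inj₁ (inj₁ p))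
  L-braid f d c (inj₁ (inj₁ (inj₂ (y , p , q)))) = inj₁ (inj₂ (y , inj₁ p , q))
  L-braid f d c (inj₁ (inj₂ (y , inj₁ p , q))) = inj₁ (inj₁ (inj₂ (y , p , q)))
  L-braid f d c (inj₁ (inj₂ (y , inj₂ (z , p , r) , q))) = inj₂ (y , inj₂ (z , inj₁ p , r) , q)
  L-braid f d c (inj₂ (y , inj₁ (inj₁ p) , q)) = inj₁ (inj₂ (y , inj₁ p , q))
  -- Omitting the middle letter leaves s twice, which idempotence reduces to the single s inside t s
  -- t.
  L-braid {s} f d c (inj₂ (y , inj₁ (inj₂ (z , p , r)) , q)) =
    inj₁ (inj₂ (z , inj₁ p , (q ⊙ U-cong s r ⊙ U-idem s z)))
  L-braid f d c (inj₂ (y , inj₂ (z , inj₁ p , r) , q)) = inj₁ (inj₂ (y , inj₂ (z , p , r) , q))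
  L-braid {s} {t} f d c (inj₂ (y , inj₂ (z , inj₂ (w , p , o) , r) , q)) =
    inj₂ (U s (U t w) , inj₂ (U t w , inj₂ (w , p , ≈-refl) , ≈-refl) ,
      (q ⊙ U-cong s r ⊙ U-cong s (U-cong t o) ⊙ c p f))

  -- Length, element and `L` are preserved together, so that several such rewritings can be chained.
  record EndsIn (t : ℕ) (b : List ℕ) : Set where
    constructor mkEnds
    field
      c : List ℕ
      len-eq : length (t ∷ c) ≡ length b
      E-eq : E (t ∷ c) ≈ E b
      L-eq : (t ∷ c) ≋ b
      ascending : Ascending (t ∷ c)

  -- Exchange, uniqueness and relations are proved jointly: exchange at length n uses all three
  -- below n, and the other two at n use exchange at n.
  Ex Un Br Q : ℕ → Set
  Ex n = ∀ b → Ascending b → length b ≡ n → ∀ t → ¬ Asc t (E b) → EndsIn t b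
  Un n = ∀ b b′ → Ascending b → Ascending b′ → length b ≡ n → E b ≈ E b′ → length b′ ≡ n × b ≋ b′
  Br n = ∀ b → Ascending b → length b ≡ n → Comm (E b) × Braid (E b)
  Q n = Ex n × Un n × Br n

  module Step (n : ℕ) (IH : ∀ {m} → m < n → Q m) where

    -- Otherwise pruning d would give an ascending word shorter than n for the same element, and
    -- uniqueness for it would force b to be that short.
    ascending-of-length : ∀ b d → Ascending b → length b ≡ n → length d ≡ n → E d ≈ E b → Ascending d
    ascending-of-length b d a lb ld p with prune d
    ... | inj₁ q = q
    ... | inj₂ (c , ac , lc , q) = ⊥-elim (<-irrefl (trans (sym (proj₁ r)) lb) c<n)
      where
        c<n : length c < n
        c<n = subst (length c <_) ld lc
        r = proj₁ (proj₂ (IH c<n)) c b ac a refl (q ⊙ p)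

    BrW : ∀ w → length w < n → Comm (E w) × Braid (E w)
    BrW w l with prune-≤ w
    ... | c , a , l′ , q with proj₂ (proj₂ (IH (≤-trans (s≤s l′) l))) c a refl
    ...   | cm , br = Comm-resp q (λ {s} {t} → cm {s} {t}) , Braid-resp q (λ {s} {t} → br {s} {t})

    L-Br : ∀ d → length d < n → ∀ {y} → L d y → Comm y × Braid y
    L-Br d l p with L-word d p
    ... | c , l′ , q with BrW c (≤-trans (s≤s l′) l)
    ...   | cm , br = Comm-resp (≈-sym q) (λ {s} {t} → cm {s} {t}) , Braid-resp (≈-sym q) (λ {s} {t} → br {s} {t})

    Third : ℕ → ℕ → X → Set
    Third s t y = Bad s t y × ∃ λ u → u ≢ s × u ≢ t × ¬ Asc u y

    -- The descent t at y rules out the full hexagon, so the orbit over `E c` is collapsed. Over `e`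
    -- the words t s and s t have the same `L` by inspection; otherwise the last letter applied in c
    -- descends at `E c`, hence at the top.
    near-min : ∀ s t c {y} → U s (U t (E c)) ≈ y → Near s t → Asc s (E c) → Asc t (E c) → ¬ Asc t y →
      (U t (U s (E c)) ≈ U s (U t (E c)) × (t ∷ s ∷ c) ≋ (s ∷ t ∷ c)) ⊎ Third s t y
    near-min s t c y≈ nr as at dt with near (E c) (near-sym nr) at as
    ... | _ , inj₁ (a , _) = ⊥-elim (dt (Asc-resp t y≈ a))
    near-min s t [] y≈ nr as at dt | _ , inj₂ (p , _) = inj₁ (≈-sym p , go s t (≈-sym p) , go t s p)
      where
        go : ∀ s t → U t (U s e) ≈ U s (U t e) → ∀ {x} → L (t ∷ s ∷ []) x → L (s ∷ t ∷ []) x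
        go s t p (inj₁ (inj₁ q)) = inj₁ (inj₁ q)
        go s t p (inj₁ (inj₂ (z , q , r))) = inj₂ (z , inj₁ q , r)
        go s t p (inj₂ (z , inj₁ q , r)) = inj₁ (inj₂ (z , q , r))
        go s t p (inj₂ (y , inj₂ (z , q , r) , o)) =
          inj₂ (U t e , inj₂ (e , ≈-refl , ≈-refl) , (o ⊙ U-cong t (r ⊙ U-cong s q) ⊙ p))
    near-min s t (u ∷ c) y≈ nr as at dt | _ , inj₂ (_ , bad , dz) =
      inj₂ (Bad-resp y≈ (Bad-sym bad) , u ,
        (λ { refl → du as }) , (λ { refl → du at }) , Desc-resp u y≈ (dz u du))
      where
        du : ¬ Asc u (E (u ∷ c))
        du = ¬Asc-U u (E c)

    -- Descend from `E (s ∷ b)` by s, t, s alternately for as long as possible. Stopping after one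
    -- or two steps exposes the bottom of the orbit, where the local axioms or commutation apply;
    -- after three steps the braid relation rewrites the word, and commuting letters cannot get that
    -- far.
    try : ∀ s b → Ascending (s ∷ b) → length (s ∷ b) ≡ n → ∀ t → s ≢ t → ¬ Asc t (E (s ∷ b)) →
          EndsIn t (s ∷ b) ⊎ Third s t (E (s ∷ b))
    try s b (ab , as) lb t s≢t dt with asc? t (E b)
    ... | yes at = inj₂ (from-min (near-or-far s≢t))
      where
        from-min : Near s t ⊎ Far s t → Third s t (E (s ∷ b))
        from-min (inj₁ nr) = ⊥-elim (dt (proj₁ (near (E b) nr as at)))
        from-min (inj₂ fr) with far (E b) fr as at
        ... | inj₁ (a , _) = ⊥-elim (dt a)
        ... | inj₂ (_ , r) = r
    ... | no dtb with proj₁ (IH (≤-reflexive lb)) b ab refl t dtb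
    ... | mkEnds c lc Ec Lc (ac , atc) = go (near-or-far s≢t) (asc? s (E c))
      where
        lc′ : suc (suc (length c)) ≡ n
        lc′ = trans (cong suc lc) lb
        c<n : length c < n
        c<n = ≤-trans (s≤s (m≤n⇒m≤1+n ≤-refl)) (≤-reflexive lc′)
        finish : ∀ c′ → length (t ∷ c′) ≡ n → E (t ∷ c′) ≈ E (s ∷ b) → (t ∷ c′) ≋ (s ∷ b) → EndsIn t (s ∷ b)
        finish c′ l E≈ L≋ = mkEnds c′ (trans l (sym lb)) E≈ L≋ (ascending-of-length (s ∷ b) (t ∷ c′) (ab , as) lb l E≈)
        go : Near s t ⊎ Far s t → Dec (Asc s (E c)) → EndsIn t (s ∷ b) ⊎ Third s t (E (s ∷ b))
        go (inj₁ nr) (yes asc) with near-min s t c (U-cong s Ec) nr asc atc dt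
        ... | inj₂ r = inj₂ r
        ... | inj₁ (p , q) = inj₁ (finish (s ∷ c) lc′ (p ⊙ U-cong s Ec)
                (≋-trans {t ∷ s ∷ c} {s ∷ t ∷ c} {s ∷ b} q (≋-cons s {t ∷ c} {b} Lc)))
        go (inj₂ fr) (yes asc) = inj₁ (finish (s ∷ c) lc′ (≈-sym (proj₁ (BrW c c<n) (far-sym fr)) ⊙ U-cong s Ec)
                (≋-trans {t ∷ s ∷ c} {s ∷ t ∷ c} {s ∷ b}
                  (L-comm (far-sym fr) c (λ p → proj₁ (L-Br c c<n p)) , L-comm fr c (λ p → proj₁ (L-Br c c<n p)))
                  (≋-cons s {t ∷ c} {b} Lc)))
        go k (no dsc) with proj₁ (IH c<n) c ac refl s dsc
        ... | mkEnds d ld Ed Ld (ad , asd) = go′ k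
          where
            d<n : length d < n
            d<n = ≤-trans (≤-reflexive ld) (<⇒≤ c<n)
            Eb : U t (U s (E d)) ≈ E b
            Eb = U-cong t Ed ⊙ Ec
            Lb : (s ∷ t ∷ s ∷ d) ≋ (s ∷ b)
            Lb = ≋-cons s {t ∷ s ∷ d} {b} (≋-trans {t ∷ s ∷ d} {t ∷ c} {b} (≋-cons t {s ∷ d} {c} Ld) Lc)
            br : ∀ {s t} → Near s t → ∀ {x} → L (s ∷ t ∷ s ∷ d) x → L (t ∷ s ∷ t ∷ d) x
            br nr = L-braid nr d (λ p → proj₂ (L-Br d d<n p))
            go′ : Near s t ⊎ Far s t → EndsIn t (s ∷ b) ⊎ Third s t (E (s ∷ b))
            -- Commuting s past t would make s a descent of `E b`, although `s ∷ b` ascends.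
            go′ (inj₂ fr) = ⊥-elim (Desc-resp s (≈-sym (proj₁ (BrW d d<n) fr) ⊙ Eb) (¬Asc-U s _) as)
            go′ (inj₁ nr) = inj₁ (finish (s ∷ t ∷ d) (trans (cong (λ k → suc (suc k)) ld) lc′)
              (≈-sym (proj₂ (BrW d d<n) nr) ⊙ U-cong s Eb)
              (≋-trans {t ∷ s ∷ t ∷ d} {s ∷ t ∷ s ∷ d} {s ∷ b} (br (near-sym nr) , br nr) Lb))

    ex : Ex n
    ex [] _ _ t dt = ⊥-elim (dt (Asc-e t))
    ex (s ∷ b) a lb t dt with s ≟ t
    ... | yes refl = mkEnds b refl ≈-refl (≋-refl {s ∷ b}) a
    ... | no s≢t with try s b a lb t s≢t dt
    ...   | inj₁ r = r
    -- A third descent u forms good pairs with both s and t, since Bad s _ has at most one solution.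
    ...   | inj₂ (bad , u , u≢s , u≢t , du) with try s b a lb u (λ p → u≢s (sym p)) du
    ...     | inj₂ (bad′ , _) = ⊥-elim (u≢t (Bad-unique bad bad′))
    ...     | inj₁ (mkEnds c lc Ec Lc ac) with try u c ac (trans lc lb) t u≢t (Desc-resp t (≈-sym Ec) dt)
    ...       | inj₂ (bad′ , _) = ⊥-elim (u≢s (Bad-unique (Bad-sym bad) (Bad-sym (Bad-resp Ec bad′))))
    ...       | inj₁ (mkEnds d ld Ed Ld ad) =
                  mkEnds d (trans ld lc) (Ed ⊙ Ec) (≋-trans {t ∷ d} {u ∷ c} {s ∷ b} Ld Lc) ad

    -- Rewrite b to end in the last letter applied in b′, then cancel that letter by injectivity on
    -- ascents.
    un : Un n
    un [] [] _ _ l _ = l , ≋-refl {[]}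
    un [] (t ∷ b′) _ (_ , at) _ p = ⊥-elim (Desc-resp t (≈-sym p) (U-asc t at) (Asc-e t))
    un (s ∷ b) [] (_ , as) _ _ p = ⊥-elim (Desc-resp s p (U-asc s as) (Asc-e s))
    un b@(_ ∷ _) (t ∷ b′) a (ab′ , at) lb p with ex b a lb t (Desc-resp t (≈-sym p) (U-asc t at))
    ... | mkEnds c lc Ec Lc (ac , atc) =
      trans (cong suc (proj₁ r)) lc′ , ≋-trans {b} {t ∷ c} {t ∷ b′} (≋-sym {t ∷ c} {b} Lc) (≋-cons t {c} {b′} (proj₂ r))
      where
        lc′ : length (t ∷ c) ≡ n
        lc′ = trans lc lb
        r = proj₁ (proj₂ (IH (≤-reflexive lc′))) c b′ ac ab′ refl (U-inj t atc at (Ec ⊙ p))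

    -- If a letter t of the pair descends at `E b`, then `E b` is `U t x` with x reached by a
    -- shorter word, and the relation at x passes up by idempotence. If both letters ascend, the
    -- local axioms apply; in a collapsed orbit both sides of the relation equal its top.
    br : Br n
    br b ab lb = cm , brd
      where
        below : ∀ t → ¬ Asc t (E b) → ∃ λ x → Comm x × Braid x × U t x ≈ E b
        below t dt with ex b ab lb t dt
        ... | mkEnds c lc Ec Lc (ac , atc) with proj₂ (proj₂ (IH (≤-reflexive (trans lc lb)))) c ac refl
        ...   | cm , br = E c , cm , br , Ec
        cm-half : ∀ {s t} → Far s t → ¬ Asc t (E b) → U t (U s (E b)) ≈ U s (U t (E b))
        cm-half {s} {t} f dt with below t dt
        ... | x , cm , _ , q =
          U-cong t (U-cong s (≈-sym q) ⊙ ≈-sym (cm f)) ⊙ U-idem t _ ⊙ cm f ⊙ U-cong s q ⊙ U-cong s (≈-sym (U-desc t dt))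
        brd-half : ∀ {s t} → Near s t → ¬ Asc t (E b) → U s (U t (U s (E b))) ≈ U t (U s (U t (E b)))
        brd-half {s} {t} f dt with below t dt
        ... | x , _ , br , q =
          U-cong s (U-cong t (U-cong s (≈-sym q))) ⊙ U-cong s (br (near-sym f)) ⊙ U-idem s _ ⊙ br f
          ⊙ U-cong t (U-cong s (q ⊙ ≈-sym (U-desc t dt)))
        cm : Comm (E b)
        cm {s} {t} f with asc? s (E b) | asc? t (E b)
        ... | _ | no dt = cm-half f dt
        ... | no ds | yes _ = ≈-sym (cm-half (far-sym f) ds)
        ... | yes as | yes at with far (E b) f as at
        ...   | inj₁ (_ , p) = p
        ...   | inj₂ (p , _) = U-cong t p ⊙ U-idem t _ ⊙ ≈-sym p ⊙ ≈-sym (U-idem s _) ⊙ U-cong s p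
        brd : Braid (E b)
        brd {s} {t} f with asc? s (E b) | asc? t (E b)
        ... | _ | no dt = brd-half f dt
        ... | no ds | yes _ = ≈-sym (brd-half (near-sym f) ds)
        ... | yes as | yes at with near (E b) f as at
        ...   | _ , inj₁ (_ , p) = p
        ...   | _ , inj₂ (p , _) = U-cong s p ⊙ U-idem s _ ⊙ ≈-sym p ⊙ ≈-sym (U-idem t _) ⊙ U-cong t p

  ascending-words : ∀ n → Q n
  ascending-words = <-rec Q (λ n IH → let open Step n IH in ex , un , br)

  descent-word : ∀ b → Ascending b → ∀ t → ¬ Asc t (E b) → EndsIn t b
  descent-word b a = proj₁ (ascending-words (length b)) b a refl

  same-length : ∀ b b′ → Ascending b → Ascending b′ → E b ≈ E b′ → length b′ ≡ length b
  same-length b b′ a a′ p = proj₁ (proj₁ (proj₂ (ascending-words (length b))) b b′ a a′ refl p)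

  shortest : ∀ b w → Ascending b → E w ≈ E b → length b ≤ length w
  shortest b w a p with prune-≤ w
  ... | c , ac , l , r = ≤-trans (≤-reflexive (same-length c b ac a (r ⊙ p))) l

  ascending-of-length : ∀ b d → Ascending b → length d ≡ length b → E d ≈ E b → Ascending d
  ascending-of-length b d a l p with prune d
  ... | inj₁ q = q
  ... | inj₂ (c , ac , lc , q) = ⊥-elim (<-irrefl refl
        (≤-trans lc (≤-trans (≤-reflexive l) (shortest b c a (q ⊙ p)))))

  E-++ : ∀ p {v w} → E v ≈ E w → E (p ++ v) ≈ E (p ++ w)
  E-++ [] eq = eq
  E-++ (s ∷ p) eq = U-cong s (E-++ p eq)

  ascending-suffix : ∀ p {w} → Ascending (p ++ w) → Ascending w
  ascending-suffix [] a = a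
  ascending-suffix (s ∷ p) (a , _) = ascending-suffix p a

  L-delete : ∀ r c w → L (r ++ c ∷ w) (E (r ++ w))
  L-delete [] c w = inj₁ (L-self w)
  L-delete (s ∷ r) c w = inj₂ (_ , L-delete r c w , ≈-refl)

  length-delete : ∀ r (c : ℕ) v → length (r ++ c ∷ v) ≡ suc (length (r ++ v))
  length-delete [] c v = refl
  length-delete (_ ∷ r) c v = cong suc (length-delete r c v)

  -- When two or more letters are omitted only the length is recorded: it suffices to exclude this
  -- case by comparison with an ascending word.
  L-cases : ∀ w {x} → L w x →
    x ≈ E w ⊎
    (∃ λ r → ∃ λ c → ∃ λ v → w ≡ r ++ c ∷ v × x ≈ E (r ++ v)) ⊎
    (∃ λ d → suc (suc (length d)) ≤ length w × x ≈ E d)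
  L-cases [] p = inj₁ p
  L-cases (s ∷ w) (inj₁ p) with L-cases w p
  ... | inj₁ q = inj₂ (inj₁ ([] , s , w , refl , q))
  ... | inj₂ (inj₁ (r , c , v , refl , q)) =
        inj₂ (inj₂ (r ++ v , s≤s (≤-reflexive (sym (length-delete r c v))) , q))
  ... | inj₂ (inj₂ (d , l , q)) = inj₂ (inj₂ (d , m≤n⇒m≤1+n l , q))
  L-cases (s ∷ w) (inj₂ (y , p , o)) with L-cases w p
  ... | inj₁ q = inj₁ (o ⊙ U-cong s q)
  ... | inj₂ (inj₁ (r , c , v , refl , q)) = inj₂ (inj₁ (s ∷ r , c , v , refl , (o ⊙ U-cong s q)))
  ... | inj₂ (inj₂ (d , l , q)) = inj₂ (inj₂ (s ∷ d , s≤s l , (o ⊙ U-cong s q)))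

  not-shorter : ∀ d v → Ascending d → E d ≈ E v → ¬ length v < length d
  not-shorter d v a p lt = <-irrefl refl (≤-trans lt (shortest d v a (≈-sym p)))

  -- Replace w by `f ∷ c` with the same `L`. A subword reaching `E d` cannot use the last f, since f
  -- ascends at `E d`; so `E d` lies in `L c`, and as c is no longer than d it must be `E c`.
  lifting : ∀ w d f → Ascending w → Ascending d → length w ≡ suc (length d) → L w (E d) →
            ¬ Asc f (E w) → Asc f (E d) → U f (E d) ≈ E w
  lifting w d f aw ad l m dw af with descent-word w aw f dw
  ... | mkEnds c lc Ec Lc _ = go (proj₂ Lc m)
    where
      lc′ : length c ≤ length d
      lc′ = ≤-reflexive (suc-injective (trans lc l))
      go : L (f ∷ c) (E d) → U f (E d) ≈ E w
      go (inj₂ (y , _ , r)) = ⊥-elim (Desc-resp f (≈-sym r) (¬Asc-U f y) af)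
      go (inj₁ m′) with L-cases c m′
      ... | inj₁ r = U-cong f r ⊙ Ec
      ... | inj₂ (inj₁ (r , x , v , refl , o)) =
            ⊥-elim (not-shorter d (r ++ v) ad o (≤-trans (≤-reflexive (sym (length-delete r x v))) lc′))
      ... | inj₂ (inj₂ (v , lt , o)) = ⊥-elim (not-shorter d v ad o (≤-trans (<⇒≤ lt) lc′))

  -- With `f ∷ c` an ascending word for `E w`, the element `E c` lies in `L w`. Its length is one
  -- less than that of w, so exactly one letter is omitted.
  exchange : ∀ w f → Ascending w → ¬ Asc f (E w) →
    ∃ λ r → ∃ λ c → ∃ λ v → w ≡ r ++ c ∷ v × U f (E (r ++ v)) ≈ E w
  exchange w f aw dw with descent-word w aw f dw
  ... | mkEnds c lc Ec Lc (ac , _) with L-cases w (proj₁ Lc (inj₁ (L-self c)))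
  ...   | inj₁ p = ⊥-elim (not-shorter w c aw (≈-sym p) (≤-reflexive lc))
  ...   | inj₂ (inj₁ (r , x , v , eq , p)) = r , x , v , eq , (U-cong f (≈-sym p) ⊙ Ec)
  ...   | inj₂ (inj₂ (d , lt , p)) = ⊥-elim (not-shorter c d ac p (≤-pred (≤-trans lt (≤-reflexive (sym lc)))))

  first-failure : ∀ w → ¬ Ascending w →
    ∃ λ p → ∃ λ f → ∃ λ v → w ≡ p ++ f ∷ v × Ascending v × ¬ Asc f (E v)
  first-failure [] na = ⊥-elim (na tt)
  first-failure (s ∷ w) na with prune w | asc? s (E w)
  ... | inj₁ a | yes as = ⊥-elim (na (a , as))
  ... | inj₁ a | no ds = [] , s , w , refl , a , ds
  ... | inj₂ (c , ac , lt , eq) | _ with first-failure w (λ a → not-shorter w c a (≈-sym eq) lt)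
  ...   | p , f , v , refl , r = s ∷ p , f , v , refl , r

  -- Common last letters cancel by injectivity. If only one deletion removes the last letter x, its
  -- result has x as an ascent while the other, still ending in x, has x as a descent.
  deletion-unique : ∀ {r₁ r₂ c₁ c₂ v₁ v₂ w} → w ≡ r₁ ++ c₁ ∷ v₁ → w ≡ r₂ ++ c₂ ∷ v₂ → Ascending w →
    Ascending (r₁ ++ v₁) → Ascending (r₂ ++ v₂) → E (r₁ ++ v₁) ≈ E (r₂ ++ v₂) → length v₁ ≡ length v₂
  deletion-unique {[]} {[]} refl refl _ _ _ _ = refl
  deletion-unique {[]} {x ∷ r₂} refl refl (_ , a) _ _ p = ⊥-elim (Desc-resp x (≈-sym p) (¬Asc-U x _) a)
  deletion-unique {x ∷ r₁} {[]} refl refl (_ , a) _ _ p = ⊥-elim (Desc-resp x p (¬Asc-U x _) a)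
  deletion-unique {x ∷ r₁} {_ ∷ r₂} refl eq (a , _) (a₁ , s₁) (a₂ , s₂) p with ∷-injective eq
  ... | refl , eq′ = deletion-unique {r₁} {r₂} refl eq′ a a₁ a₂ (U-inj x s₁ s₂ p)

  split-compare : ∀ {p p′ : List ℕ} {f c} {v v′ : List ℕ} → p ++ f ∷ v ≡ p′ ++ c ∷ v′ →
    (p ≡ p′ × v ≡ v′) ⊎
    (∃ λ r → v ≡ r ++ c ∷ v′ × p′ ≡ p ++ f ∷ r) ⊎
    (∃ λ r → v′ ≡ r ++ f ∷ v × p ≡ p′ ++ c ∷ r)
  split-compare {[]} {[]} refl = inj₁ (refl , refl)
  split-compare {[]} {x ∷ p′} refl = inj₂ (inj₁ (p′ , refl , refl))
  split-compare {x ∷ p} {[]} refl = inj₂ (inj₂ (p , refl , refl))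
  split-compare {x ∷ p} {y ∷ p′} eq with ∷-injective eq
  ... | refl , eq′ with split-compare {p} {p′} eq′
  ...   | inj₁ (refl , q) = inj₁ (refl , q)
  ...   | inj₂ (inj₁ (r , q , refl)) = inj₂ (inj₁ (r , q , refl))
  ...   | inj₂ (inj₂ (r , q , refl)) = inj₂ (inj₂ (r , q , refl))

  -- An occurrence p ++ c ∷ v of a letter is identified by length v, the number of letters applied before it.
  module FirstFailure {p : List ℕ} {f : ℕ} {v : List ℕ} (av : Ascending v) (df : ¬ Asc f (E v)) where

    -- A deletion inside p would leave the suffix `f ∷ v`, which is not ascending. A deletion inside
    -- v makes f an ascent, and lifting then identifies the element reached by f with that of v.
    locate : ∀ {p′ c v′} → p ++ f ∷ v ≡ p′ ++ c ∷ v′ → Ascending (p′ ++ v′) →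
      (p ≡ p′ × v ≡ v′) ⊎
      (∃ λ r → v ≡ r ++ c ∷ v′ × Ascending (r ++ v′) × U f (E (r ++ v′)) ≈ E v × Asc f (E (r ++ v′)) ×
        p′ ++ v′ ≡ p ++ f ∷ r ++ v′)
    locate {p′} {c} {v′} eq a with split-compare {p} {p′} eq
    ... | inj₁ q = inj₁ q
    ... | inj₂ (inj₂ (r , refl , refl)) = ⊥-elim (df (proj₂ (ascending-suffix r (ascending-suffix p′ a))))
    ... | inj₂ (inj₁ (r , refl , refl)) =
          inj₂ (r , refl , proj₁ ar , lifting _ (r ++ v′) f av (proj₁ ar) (length-delete r c v′) (L-delete r c v′) df (proj₂ ar)
            , proj₂ ar , ++-assoc p (f ∷ r) v′)
      where
        ar : Ascending (f ∷ r ++ v′)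
        ar = ascending-suffix p (subst Ascending (++-assoc p (f ∷ r) v′) a)

    -- The letter f and a position in v are partners: omitting either leaves the same element before
    -- p is applied. Lifting finds the partner of a position in v, exchange that of f.
    other : ∀ {p′ c v′} → p ++ f ∷ v ≡ p′ ++ c ∷ v′ → Ascending (p′ ++ v′) →
      ∃ λ p″ → ∃ λ c″ → ∃ λ v″ → p ++ f ∷ v ≡ p″ ++ c″ ∷ v″ × length v″ ≢ length v′ ×
        Ascending (p″ ++ v″) × E (p″ ++ v″) ≈ E (p′ ++ v′)
    other {p′} {c} {v′} eq a with locate {p′} eq a
    ... | inj₂ (r , refl , _ , up , _ , eq′) =
          p , f , v , refl , (λ l → m≢1+n+m (length v′) (trans (sym l) (trans (length-++ r) (+-suc (length r) (length v′))))) ,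
          ascending-of-length (p′ ++ v′) (p ++ v) a
            (trans (length-++ p) (trans (cong (length p +_) (length-delete r c v′)) (sym (trans (cong length eq′) (length-++ p)))))
            E≈ , E≈
      where
        E≈ : E (p ++ v) ≈ E (p′ ++ v′)
        E≈ = subst (λ z → E (p ++ v) ≈ E z) (sym eq′) (E-++ p (≈-sym up))
    ... | inj₁ (refl , refl) with exchange v f av df
    ...   | r , x , w , refl , up =
            p ++ f ∷ r , x , w , sym (++-assoc p (f ∷ r) (x ∷ w)) ,
            (λ l → m≢1+n+m (length w) (trans l (trans (length-++ r) (+-suc (length r) (length w))))) ,
            ascending-of-length (p ++ r ++ x ∷ w) ((p ++ f ∷ r) ++ w) a
              (trans (cong length (++-assoc p (f ∷ r) w)) (trans (length-++ p)
                (trans (cong (length p +_) (sym (length-delete r x w))) (sym (length-++ p))))) E≈ , E≈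
      where
        E≈ : E ((p ++ f ∷ r) ++ w) ≈ E (p ++ r ++ x ∷ w)
        E≈ = subst (λ z → E z ≈ E (p ++ r ++ x ∷ w)) (sym (++-assoc p (f ∷ r) w)) (E-++ p up)

    -- Admissible deletions in v all give elements that f raises to `E v`. By injectivity these
    -- agree, so the position in v is unique; the only other one is that of f.
    at-most-two : ∀ {p₀ c₀ v₀ p₁ c₁ v₁ p₂ c₂ v₂} →
      p ++ f ∷ v ≡ p₀ ++ c₀ ∷ v₀ → p ++ f ∷ v ≡ p₁ ++ c₁ ∷ v₁ → p ++ f ∷ v ≡ p₂ ++ c₂ ∷ v₂ →
      Ascending (p₀ ++ v₀) → Ascending (p₁ ++ v₁) → Ascending (p₂ ++ v₂) →
      length v₁ ≢ length v₀ → length v₂ ≢ length v₀ → length v₁ ≡ length v₂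
    at-most-two {p₀} {p₁ = p₁} {p₂ = p₂} eq₀ eq₁ eq₂ a₀ a₁ a₂ n₁ n₂
      with locate {p₀} eq₀ a₀ | locate {p₁} eq₁ a₁ | locate {p₂} eq₂ a₂
    ... | _ | inj₁ (_ , refl) | inj₁ (_ , refl) = refl
    ... | inj₁ (_ , refl) | inj₁ (_ , refl) | inj₂ _ = ⊥-elim (n₁ refl)
    ... | inj₁ (_ , refl) | inj₂ _ | inj₁ (_ , refl) = ⊥-elim (n₂ refl)
    ... | _ | inj₂ (r₁ , e₁ , b₁ , u₁ , s₁ , _) | inj₂ (r₂ , e₂ , b₂ , u₂ , s₂ , _) =
          deletion-unique {r₁} {r₂} e₁ e₂ av b₁ b₂ (U-inj f s₁ s₂ (u₁ ⊙ ≈-sym u₂))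
    ... | inj₂ (r₁ , e₁ , b₁ , u₁ , s₁ , _) | inj₁ _ | inj₂ (r₂ , e₂ , b₂ , u₂ , s₂ , _) =
          ⊥-elim (n₂ (deletion-unique {r₂} {r₁} e₂ e₁ av b₂ b₁ (U-inj f s₂ s₁ (u₂ ⊙ ≈-sym u₁))))
    ... | inj₂ (r₁ , e₁ , b₁ , u₁ , s₁ , _) | inj₂ (r₂ , e₂ , b₂ , u₂ , s₂ , _) | inj₁ _ =
          ⊥-elim (n₁ (deletion-unique {r₂} {r₁} e₂ e₁ av b₂ b₁ (U-inj f s₂ s₁ (u₂ ⊙ ≈-sym u₁))))

-- Deletions in a word and in its reverse.

reverse-split : ∀ u (c : ℕ) v → reverse (u ++ c ∷ v) ≡ reverse v ++ c ∷ reverse u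
reverse-split u c v = trans (reverse-++ u (c ∷ v)) (trans (cong (_++ reverse u) (unfold-reverse c v))
  (++-assoc (reverse v) (c ∷ []) (reverse u)))

splitAt : ∀ (a : List ℕ) (i : Fin (length a)) → ∃ λ u → ∃ λ c → ∃ λ v →
  a ≡ u ++ c ∷ v × removeAt a i ≡ u ++ v × toℕ i ≡ length u
splitAt (x ∷ a) Fin.zero = [] , x , a , refl , refl , refl
splitAt (x ∷ a) (Fin.suc i) with splitAt a i
... | u , c , v , p , q , r = x ∷ u , c , v , cong (x ∷_) p , cong (x ∷_) q , cong suc r

position : ∀ u (c : ℕ) v → ∃ λ (i : Fin (length (u ++ c ∷ v))) →
  removeAt (u ++ c ∷ v) i ≡ u ++ v × toℕ i ≡ length u
position [] c v = Fin.zero , refl , refl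
position (x ∷ u) c v with position u c v
... | i , p , q = Fin.suc i , cong (x ∷_) p , cong suc q

Split : (a : List ℕ) → Fin (length a) → List ℕ → ℕ → List ℕ → Set
Split a i p c v = reverse a ≡ p ++ c ∷ v × reverse (removeAt a i) ≡ p ++ v × toℕ i ≡ length v

to-split : ∀ a i → ∃ λ p → ∃ λ c → ∃ λ v → Split a i p c v
to-split a i with splitAt a i
... | u , c , v , p , q , r = reverse v , c , reverse u ,
  trans (cong reverse p) (reverse-split u c v) , trans (cong reverse q) (reverse-++ u v) ,
  trans r (sym (length-reverse u))

from-split : ∀ a {p c v} → reverse a ≡ p ++ c ∷ v → ∃ λ i → Split a i p c v
from-split a {p} {c} {v} eq with trans (sym (reverse-involutive a)) (trans (cong reverse eq) (reverse-split p c v))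
... | refl with position (reverse v) c (reverse p)
...   | i , q , r = i , eq ,
        trans (cong reverse q) (trans (reverse-++ (reverse v) (reverse p))
          (cong₂ _++_ (reverse-involutive p) (reverse-involutive v))) ,
        trans r (length-reverse v)

-- From ascending words to reduced words over a restricted alphabet.

module ReducedWords (A : LocalAction) where
  open LocalAction A
  open Exchange A
  open IsEquivalence ≈-equiv using () renaming (sym to ≈-sym)

  module _ {Y : Set} (Letter : ℕ → Set) (act : List ℕ → Y)
    (act-≈ : ∀ {a b : List ℕ} → All Letter a → All Letter b → act a ≡ act b → E (reverse a) ≈ E (reverse b))
    (≈-act : ∀ {a b : List ℕ} → All Letter a → All Letter b → E (reverse a) ≈ E (reverse b) → act a ≡ act b) where

    Reduced : List ℕ → Set
    Reduced a = All Letter a × (∀ b → All Letter b → length b < length a → act b ≢ act a)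

    NearlyReduced : Y → (a : List ℕ) → Fin (length a) → Set
    NearlyReduced τ a i = ¬ Reduced a × Reduced (removeAt a i) × act (removeAt a i) ≡ τ

    removeAt-word : ∀ {a} → All Letter a → ∀ i → All Letter (removeAt a i)
    removeAt-word (_ ∷ h) Fin.zero = h
    removeAt-word (p ∷ h) (Fin.suc i) = p ∷ removeAt-word h i

    ascending⇒reduced : ∀ {a} → All Letter a → Ascending (reverse a) → Reduced a
    ascending⇒reduced {a} h as = h , λ b hb l eq → <-irrefl refl (<-≤-trans l (subst₂ _≤_
      (length-reverse a) (length-reverse b) (shortest (reverse a) (reverse b) as (act-≈ hb h eq))))

    -- The first letter that fails to ascend acts trivially, so a is not shortest. Deleting this
    -- letter, rather than taking the pruned word, keeps the shorter word visibly within `Letter`.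
    reduced⇒ascending : ∀ {a} → Reduced a → Ascending (reverse a)
    reduced⇒ascending {a} (h , short) with prune (reverse a)
    ... | inj₁ as = as
    ... | inj₂ (c , ac , l , eq) with first-failure (reverse a) (λ as → not-shorter (reverse a) c as (≈-sym eq) l)
    ...   | p , f , v , split , _ , d with from-split a split
    ...     | i , _ , rem , _ = ⊥-elim (short (removeAt a i) (removeAt-word h i)
              (≤-reflexive (sym (length-removeAt′ a i)))
              (≈-act (removeAt-word h i) h (subst₂ (λ x y → E x ≈ E y) (sym rem) (sym split) (E-++ p (≈-sym (U-desc f d))))))

    unique-other : ∀ τ a → All Letter a → (m : Fin (length a)) → NearlyReduced τ a m →
      ∃ λ (k : Fin (length a)) → k ≢ m × NearlyReduced τ a k ×
        (∀ (k′ : Fin (length a)) → k′ ≢ m → NearlyReduced τ a k′ → k′ ≡ k)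
    unique-other τ a h m (nr , red , eqτ)
      with first-failure (reverse a) (λ as → nr (ascending⇒reduced h as)) | to-split a m
    ... | p , f , v , split , av , d | p₀ , c₀ , v₀ , sp₀ , rem₀ , pos₀
      with FirstFailure.other {p} av d (trans (sym split) sp₀) (subst Ascending rem₀ (reduced⇒ascending red))
    ... | p₁ , c₁ , v₁ , sp₁ , ne , a₁ , eq₁ with from-split a (trans split sp₁)
    ... | k , _ , rem₁ , pos₁ =
      k , (λ e → ne (trans (sym pos₁) (trans (cong toℕ e) pos₀))) ,
      (nr , ascending⇒reduced (removeAt-word h k) (subst Ascending (sym rem₁) a₁) ,
        trans (≈-act (removeAt-word h k) (removeAt-word h m) (subst₂ (λ x y → E x ≈ E y) (sym rem₁) (sym rem₀) eq₁)) eqτ) ,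
      unique
      where
        unique : ∀ k′ → k′ ≢ m → NearlyReduced τ a k′ → k′ ≡ k
        unique k′ ne′ (_ , red′ , _) with to-split a k′
        ... | p₂ , c₂ , v₂ , sp₂ , rem₂ , pos₂ = toℕ-injective (trans pos₂ (trans
          (FirstFailure.at-most-two {p} av d {p₀} {p₁ = p₂} {p₂ = p₁}
            (trans (sym split) sp₀) (trans (sym split) sp₂) sp₁
            (subst Ascending rem₀ (reduced⇒ascending red)) (subst Ascending rem₂ (reduced⇒ascending red′)) a₁
            (λ e → ne′ (toℕ-injective (trans pos₂ (trans e (sym pos₀))))) ne)
          (sym pos₁)))

-- Adjacent transpositions of ℕ.

data SwView (i : ℕ) : ℕ → ℕ → Set where
  low : SwView i i (suc i)
  high : SwView i (suc i) i
  away : ∀ {x} → x ≢ i → x ≢ suc i → SwView i x x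

opaque
  sw : ℕ → ℕ → ℕ
  sw i x = if ⌊ x ≟ i ⌋ then suc i else (if ⌊ x ≟ suc i ⌋ then i else x)

  sw-def : ∀ i x → (if ⌊ x ≟ i ⌋ then suc i else (if ⌊ x ≟ suc i ⌋ then i else x)) ≡ sw i x
  sw-def i x = refl

  sw-view : ∀ i x → SwView i x (sw i x)
  sw-view i x with x ≟ i | x ≟ suc i
  ... | yes refl | _ = low
  ... | no _ | yes refl = high
  ... | no p | no q = away p q

sw-low : ∀ i → sw i i ≡ suc i
sw-low i with sw i i | sw-view i i
... | _ | low = refl
... | _ | away p _ = ⊥-elim (p refl)

sw-high : ∀ i → sw i (suc i) ≡ i
sw-high i with sw i (suc i) | sw-view i (suc i)
... | _ | high = refl
... | _ | away _ q = ⊥-elim (q refl)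

sw-away : ∀ i {x} → x ≢ i → x ≢ suc i → sw i x ≡ x
sw-away i {x} p q with sw i x | sw-view i x
... | _ | low = ⊥-elim (p refl)
... | _ | high = ⊥-elim (q refl)
... | _ | away _ _ = refl

sw-invol : ∀ i x → sw i (sw i x) ≡ x
sw-invol i x with sw i x | sw-view i x
... | _ | low = sw-high i
... | _ | high = sw-low i
... | _ | away p q = sw-away i p q

sw-adj : ∀ i {x y} → sw i x ≡ y → x ≡ sw i y
sw-adj i {x} refl = sym (sw-invol i x)

sw-comm : ∀ {i j} → Far i j → ∀ x → sw i (sw j x) ≡ sw j (sw i x)
sw-comm {i} {j} (p , q , r) x with sw i x | sw-view i x | sw j x | sw-view j x
... | _ | low | _ | low = ⊥-elim (p refl)
... | _ | low | _ | high = ⊥-elim (r refl)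
... | _ | low | _ | away _ _ = trans (sw-low i) (sym (sw-away j q (λ e → p (suc-injective e))))
... | _ | high | _ | low = ⊥-elim (q refl)
... | _ | high | _ | high = ⊥-elim (p refl)
... | _ | high | _ | away _ _ = trans (sw-high i) (sym (sw-away j p (λ e → r (sym e))))
... | _ | away _ _ | _ | low = trans (sw-away i r (λ e → p (suc-injective (sym e)))) (sym (sw-low j))
... | _ | away _ _ | _ | high = trans (sw-away i (λ e → p (sym e)) (λ e → q (sym e))) (sym (sw-high j))
... | _ | away a b | _ | away c d = trans (sw-away i a b) (sym (sw-away j c d))

n≢2+n : ∀ {n} → n ≢ suc (suc n)
n≢2+n {suc n} e = n≢2+n (suc-injective e)

sw-above : ∀ i → sw i (suc (suc i)) ≡ suc (suc i)
sw-above i = sw-away i (λ e → n≢2+n (sym e)) 1+n≢n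

sw-below : ∀ i → sw (suc i) i ≡ i
sw-below i = sw-away (suc i) (λ e → 1+n≢n (sym e)) n≢2+n

sw-braid : ∀ i x → sw i (sw (suc i) (sw i x)) ≡ sw (suc i) (sw i (sw (suc i) x))
sw-braid i x with sw i x | sw-view i x | sw (suc i) x | sw-view (suc i) x
... | _ | low | _ | away _ _ rewrite sw-low (suc i) | sw-above i | sw-low i | sw-low (suc i) = refl
... | _ | high | _ | low rewrite sw-below i | sw-low i | sw-above i | sw-high (suc i) = refl
... | _ | high | _ | away p _ = ⊥-elim (p refl)
... | _ | away _ q | _ | low = ⊥-elim (q refl)
... | _ | away _ _ | _ | high rewrite sw-high (suc i) | sw-high i | sw-below i = refl
... | _ | away a b | _ | away c d rewrite sw-away (suc i) c d | sw-away i a b | sw-away (suc i) c d = refl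

-- As i and i + 1 are adjacent, they form the only pair whose order is reversed.
sw-mono : ∀ i {x y} → x < y → ¬ (x ≡ i × y ≡ suc i) → sw i x < sw i y
sw-mono i {x} {y} x<y n with sw i x | sw-view i x | sw i y | sw-view i y
... | _ | low | _ | low = ⊥-elim (<-irrefl refl x<y)
... | _ | low | _ | high = ⊥-elim (n (refl , refl))
... | _ | low | _ | away p q = ≤∧≢⇒< x<y (λ e → q (sym e))
... | _ | high | _ | low = ⊥-elim (<-asym x<y (n<1+n i))
... | _ | high | _ | high = ⊥-elim (<-irrefl refl x<y)
... | _ | high | _ | away p q = <⇒≤ x<y
... | _ | away p q | _ | low = m≤n⇒m≤1+n x<y
... | _ | away p q | _ | high = ≤∧≢⇒< (≤-pred x<y) p
... | _ | away _ _ | _ | away _ _ = x<y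

-- States of μ-involutions and the action of a letter.

-- The μ-involution with blocks B_r is encoded by β v = the r with v ∈ B_r and by the
-- involution θ sending the j-th smallest value of a block to its j-th letter.
record State : Set where
  field
    β θ : ℕ → ℕ
    θ-invol : ∀ v → θ (θ v) ≡ v
    β-θ : ∀ v → β (θ v) ≡ β v
open State

infix 4 _≈_
record _≈_ (M N : State) : Set where
  constructor agree
  field
    β≡ : ∀ v → β M v ≡ β N v
    θ≡ : ∀ v → θ M v ≡ θ N v
open _≈_

≈-refl : ∀ {M} → M ≈ M
≈-refl = agree (λ _ → refl) (λ _ → refl)

≈-sym : ∀ {M N} → M ≈ N → N ≈ M
≈-sym (agree p q) = agree (λ v → sym (p v)) (λ v → sym (q v))

≈-trans : ∀ {M N P} → M ≈ N → N ≈ P → M ≈ P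
≈-trans (agree p q) (agree p′ q′) = agree (λ v → trans (p v) (p′ v)) (λ v → trans (q v) (q′ v))

θ-inj : ∀ M {x y} → θ M x ≡ θ M y → x ≡ y
θ-inj M {x} {y} e = trans (sym (θ-invol M x)) (trans (cong (θ M) e) (θ-invol M y))

θ-adj : ∀ M {x y} → θ M x ≡ y → θ M y ≡ x
θ-adj M {x} refl = θ-invol M x

-- The letter x is written before y in one-line notation: within its block, x stands in the slot of
-- the inverse image of x under θ, which is θ x.
lt : State → ℕ → ℕ → Set
lt M x y = β M x < β M y ⊎ (β M x ≡ β M y × θ M x < θ M y)

lt-θ : ∀ M {x y} → lt M x y → β M x ≡ β M y → θ M x < θ M y
lt-θ M (inj₁ p) e = ⊥-elim (<-irrefl e p)
lt-θ M (inj₂ (_ , p)) _ = p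

lt-β : ∀ M {x y} → lt M x y → β M x ≤ β M y
lt-β M (inj₁ p) = <⇒≤ p
lt-β M (inj₂ (p , _)) = ≤-reflexive p

lt-trans : ∀ M {x y z} → lt M x y → lt M y z → lt M x z
lt-trans M (inj₁ p) q = inj₁ (<-≤-trans p (lt-β M q))
lt-trans M (inj₂ (p , _)) (inj₁ q) = inj₁ (≤-<-trans (≤-reflexive p) q)
lt-trans M (inj₂ (p , p′)) (inj₂ (q , q′)) = inj₂ (trans p q , <-trans p′ q′)

lt-asym : ∀ M {x y} → lt M x y → ¬ lt M y x
lt-asym M (inj₁ p) q = <-irrefl refl (<-≤-trans p (lt-β M q))
lt-asym M (inj₂ (p , p′)) q = <-asym p′ (lt-θ M q (sym p))

lt-resp : ∀ {M N} → M ≈ N → ∀ {x y} → lt M x y → lt N x y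
lt-resp (agree p q) {x} {y} (inj₁ l) = inj₁ (subst₂ _<_ (p x) (p y) l)
lt-resp (agree p q) {x} {y} (inj₂ (e , l)) =
  inj₂ (trans (sym (p x)) (trans e (p y)) , subst₂ _<_ (q x) (q y) l)

Asc : ℕ → State → Set
Asc i M = lt M i (suc i)

asc? : ∀ i M → Dec (Asc i M)
asc? i M = (β M i <? β M (suc i)) ⊎-dec ((β M i ≟ β M (suc i)) ×-dec (θ M i <? θ M (suc i)))

-- Among ascents at i, exactly those where conjugation by s_i changes nothing.
Fixed : ℕ → State → Set
Fixed i M = β M i ≡ β M (suc i) × θ M i ≡ i × θ M (suc i) ≡ suc i

fixed? : ∀ i M → Dec (Fixed i M)
fixed? i M = (β M i ≟ β M (suc i)) ×-dec ((θ M i ≟ i) ×-dec (θ M (suc i) ≟ suc i))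

Fixed-resp : ∀ {i M N} → M ≈ N → Fixed i M → Fixed i N
Fixed-resp {i} (agree p q) (a , b , c) =
  trans (sym (p i)) (trans a (p (suc i))) , trans (sym (q i)) b , trans (sym (q (suc i))) c

-- One formula for two cases: across blocks it is s_i ∘ π, a relabelling of values; inside a block β
-- is unchanged and θ is multiplied on both sides.
conj : ℕ → State → State
conj i M = record
  { β = λ v → β M (sw i v)
  ; θ = λ v → sw i (θ M (sw i v))
  ; θ-invol = λ v → trans (cong (λ k → sw i (θ M k)) (sw-invol i _))
                      (trans (cong (sw i) (θ-invol M _)) (sw-invol i v))
  ; β-θ = λ v → trans (cong (β M) (sw-invol i _)) (β-θ M _)
  }

θ-sw : ∀ M i → Fixed i M → ∀ v → θ M (sw i v) ≡ sw i (θ M v)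
θ-sw M i (_ , f , g) v with sw i v | sw-view i v
... | _ | low = trans g (trans (sym (sw-low i)) (cong (sw i) (sym f)))
... | _ | high = trans f (trans (sym (sw-high i)) (cong (sw i) (sym g)))
... | _ | away p q = sym (sw-away i (λ e → p (θ-inj M (trans e (sym f)))) (λ e → q (θ-inj M (trans e (sym g)))))

β-sw : ∀ M i → β M i ≡ β M (suc i) → ∀ v → β M (sw i v) ≡ β M v
β-sw M i b v with sw i v | sw-view i v
... | _ | low = sym b
... | _ | high = b
... | _ | away _ _ = refl

-- When s_i commutes with θ the Hecke product absorbs the second factor, leaving θ s_i: two fixed
-- points are joined into a 2-cycle.
link : (i : ℕ) (M : State) → Fixed i M → State
link i M F@(b , f , g) = record
  { β = β M
  ; θ = λ v → θ M (sw i v)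
  ; θ-invol = λ v → trans (cong (λ k → θ M (sw i k)) (θ-sw M i F v))
                      (trans (cong (θ M) (sw-invol i _)) (θ-invol M v))
  ; β-θ = λ v → trans (β-θ M _) (β-sw M i b v)
  }

conj-cong : ∀ i {M N} → M ≈ N → conj i M ≈ conj i N
conj-cong i (agree p q) = agree (λ v → p (sw i v)) (λ v → cong (sw i) (q (sw i v)))

-- The excluded configuration puts x and y into the slots i and i + 1 of one block, the only pair of
-- slots that s_i reverses.
conj-lt : ∀ M i {x y x′ y′} → sw i x′ ≡ x → sw i y′ ≡ y → lt M x y →
          ¬ (β M x ≡ β M y × θ M x ≡ i × θ M y ≡ suc i) → lt (conj i M) x′ y′
conj-lt M i refl refl (inj₁ p) n = inj₁ p
conj-lt M i refl refl (inj₂ (e , p)) n = inj₂ (e , sw-mono i p (λ (a , b) → n (e , a , b)))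

conj-desc : ∀ M i → Asc i M → ¬ Fixed i M → lt (conj i M) (suc i) i
conj-desc M i a nf = conj-lt M i (sw-high i) (sw-low i) a nf

link-desc : ∀ M i F → lt (link i M F) (suc i) i
link-desc M i (b , f , g) = inj₂ (sym b , subst₂ _<_ (sym (trans (cong (θ M) (sw-high i)) f))
  (sym (trans (cong (θ M) (sw-low i)) g)) (n<1+n i))

conj-invol : ∀ i M → conj i (conj i M) ≈ M
conj-invol i M = agree (λ v → cong (β M) (sw-invol i v))
  (λ v → trans (sw-invol i _) (cong (θ M) (sw-invol i v)))

-- A linked state has the 2-cycle (i i+1) in one block. Conjugation by s_i preserves that cycle, so
-- N would have it too, and i would be a descent of N.
link≉conj : ∀ i {M N} (F : Fixed i M) → Asc i N → ¬ (link i M F ≈ conj i N)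
link≉conj i {M} {N} (b , f , g) a (agree _ q) = <-asym (n<1+n i) (subst₂ _<_ θi θsi (lt-θ N a eβ))
  where
    θsi : θ N (suc i) ≡ i
    θsi = trans (sym (sw-invol i _)) (trans (cong (sw i) (trans (cong (λ k → sw i (θ N k)) (sym (sw-low i)))
            (trans (sym (q i)) (trans (cong (θ M) (sw-low i)) g)))) (sw-high i))
    θi : θ N i ≡ suc i
    θi = θ-adj N θsi
    eβ : β N i ≡ β N (suc i)
    eβ = trans (sym (cong (β N) θsi)) (β-θ N (suc i))

opaque
  U : ℕ → State → State
  U i M with asc? i M | fixed? i M
  ... | no _ | _ = M
  ... | yes _ | yes f = link i M f
  ... | yes _ | no _ = conj i M

  U-conj : ∀ {i M N} → M ≈ N → Asc i N → ¬ Fixed i N → U i M ≈ conj i N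
  U-conj {i} {M} p a nf with asc? i M | fixed? i M
  ... | no na | _ = ⊥-elim (na (lt-resp (≈-sym p) a))
  ... | yes _ | yes f = ⊥-elim (nf (Fixed-resp p f))
  ... | yes _ | no _ = conj-cong i p

  U-link : ∀ {i M N} → M ≈ N → Asc i N → (F : Fixed i N) → U i M ≈ link i N F
  U-link {i} {M} p a F with asc? i M | fixed? i M
  ... | no na | _ = ⊥-elim (na (lt-resp (≈-sym p) a))
  ... | yes _ | yes f = agree (β≡ p) (λ v → θ≡ p (sw i v))
  ... | yes _ | no nf = ⊥-elim (nf (Fixed-resp (≈-sym p) F))

  U-desc : ∀ i {M} → ¬ Asc i M → U i M ≈ M
  U-desc i {M} na with asc? i M | fixed? i M
  ... | no _ | _ = ≈-refl
  ... | yes a | _ = ⊥-elim (na a)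

  U-cong : ∀ i {M N} → M ≈ N → U i M ≈ U i N
  U-cong i {M} {N} p with asc? i N | fixed? i N
  ... | no na | _ = ≈-trans (U-desc i (λ a → na (lt-resp p a))) p
  ... | yes a | yes f = U-link p a f
  ... | yes a | no nf = U-conj p a nf

  U-asc : ∀ i {M} → Asc i M → ¬ Asc i (U i M)
  U-asc i {M} a with asc? i M | fixed? i M
  ... | no na | _ = ⊥-elim (na a)
  ... | yes _ | yes f = lt-asym (link i M f) (link-desc M i f)
  ... | yes _ | no nf = lt-asym (conj i M) (conj-desc M i a nf)

  U-inj : ∀ i {M N} → Asc i M → Asc i N → U i M ≈ U i N → M ≈ N
  U-inj i {M} {N} aM aN p with asc? i M | fixed? i M | asc? i N | fixed? i N
  ... | no na | _ | _ | _ = ⊥-elim (na aM)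
  ... | yes _ | _ | no na | _ = ⊥-elim (na aN)
  ... | yes _ | yes f | yes _ | no _ = ⊥-elim (link≉conj i {M} {N} f aN p)
  ... | yes _ | no _ | yes _ | yes g = ⊥-elim (link≉conj i {N} {M} g aM (≈-sym p))
  ... | yes _ | yes f | yes _ | yes g = agree (β≡ p) λ v →
        trans (cong (θ M) (sym (sw-invol i v))) (trans (θ≡ p (sw i v)) (cong (θ N) (sw-invol i v)))
  ... | yes _ | no _ | yes _ | no _ =
        ≈-trans (≈-sym (conj-invol i M)) (≈-trans (conj-cong i p) (conj-invol i N))

-- For commuting s , t this is the top over two crossed 2-cycles (s t)(s+1 t+1); for t = s ± 1 it is
-- the 2-cycle joining the outer two of three consecutive fixed points.
Bad : ℕ → ℕ → State → Set
Bad s t M = θ M s ≡ suc t × θ M (suc s) ≡ t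

Bad-sym : ∀ {s t M} → Bad s t M → Bad t s M
Bad-sym {M = M} (p , q) = θ-adj M q , θ-adj M p

Bad-resp : ∀ {s t M N} → M ≈ N → Bad s t M → Bad s t N
Bad-resp (agree _ r) (p , q) = trans (sym (r _)) p , trans (sym (r _)) q

-- If every adjacent pair from x to w ascended, transitivity would put x before w.
between : ∀ M {x w} → x < w → lt M w x → ∃ λ u → x ≤ u × u < w × ¬ Asc u M
between M {x} {suc w} (s≤s x≤w) l with asc? w M
... | no na = w , x≤w , n<1+n w , na
... | yes a with m≤n⇒m<n∨m≡n x≤w
...   | inj₂ refl = ⊥-elim (lt-asym M a l)
...   | inj₁ x<w with between M x<w (lt-trans M a l)
...     | u , p , q , r = u , p , m≤n⇒m≤1+n q , r

fix-conj : ∀ M i {x x′} → sw i x′ ≡ x → θ (conj i M) x′ ≡ x′ → θ M x ≡ x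
fix-conj M i refl e = sw-adj i e

conj-fix : ∀ M i {x x′} → sw i x′ ≡ x → θ M x ≡ x → θ (conj i M) x′ ≡ x′
conj-fix M i {x′ = x′} refl e = trans (cong (sw i) e) (sw-invol i x′)

-- Orbits of two neighbouring letters.

module NearMin (i : ℕ) (z : State) (ab : lt z i (suc i)) (bc : lt z (suc i) (suc (suc i))) where
  private
    b c : ℕ
    b = suc i
    c = suc b

    ac : lt z i c
    ac = lt-trans z ab bc

    i≢b : i ≢ b
    i≢b e = 1+n≢n (sym e)

    θ-sorted : β z i ≡ β z c → θ z i < θ z b × θ z b < θ z c
    θ-sorted e = lt-θ z ab ib , lt-θ z bc (trans (sym ib) e)
      where
        ib : β z i ≡ β z b
        ib = ≤-antisym (lt-β z ab) (≤-trans (lt-β z bc) (≤-reflexive (sym e)))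

    both-fixed : β z i ≡ β z c → θ z i ≡ i → θ z c ≡ c → Fixed i z × Fixed b z
    both-fixed e p q = (ib , p , θb) , (trans (sym ib) e , θb , q)
      where
        ib : β z i ≡ β z b
        ib = ≤-antisym (lt-β z ab) (≤-trans (lt-β z bc) (≤-reflexive (sym e)))
        θb : θ z b ≡ b
        -- As i and i + 2 are fixed, θ b lies strictly between them.
        θb = ≤-antisym (≤-pred (subst (θ z b <_) q (proj₂ (θ-sorted e))))
                       (subst (_< θ z b) p (proj₁ (θ-sorted e)))

    data Place : ℕ → Set where
      at-i : Place i
      at-b : Place b
      at-c : Place c
      out : ∀ {v} → v ≢ i → v ≢ b → v ≢ c → Place v

    place : ∀ v → Place v
    place v with v ≟ i | v ≟ b | v ≟ c
    ... | yes refl | _ | _ = at-i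
    ... | no _ | yes refl | _ = at-b
    ... | no _ | no _ | yes refl = at-c
    ... | no p | no q | no r = out p q r

    asc-bi : Asc b (conj i z)
    -- The excluded configuration θ i = i, θ c = b would give θ b = c, against θ b < θ c.
    asc-bi = conj-lt z i (sw-high i) (sw-above i) ac λ (e , p , q) →
      <-asym (n<1+n b) (subst₂ _<_ (θ-adj z q) q (proj₂ (θ-sorted e)))

    asc-ib : Asc i (conj b z)
    asc-ib = conj-lt z b (sw-below i) (sw-low b) ac λ (e , p , q) →
      <-asym (n<1+n i) (subst₂ _<_ p (θ-adj z p) (proj₁ (θ-sorted e)))

    nf-bi : ¬ (Fixed i z × Fixed b z) → ¬ Fixed b (conj i z)
    nf-bi n (e , p , q) = n (both-fixed
      (trans (cong (β z) (sym (sw-high i))) (trans e (cong (β z) (sw-above i))))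
      (fix-conj z i (sw-high i) p) (fix-conj z i (sw-above i) q))

    nf-ib : ¬ (Fixed i z × Fixed b z) → ¬ Fixed i (conj b z)
    nf-ib n (e , p , q) = n (both-fixed
      (trans (cong (β z) (sym (sw-below i))) (trans e (cong (β z) (sw-low b))))
      (fix-conj z b (sw-below i) p) (fix-conj z b (sw-low b) q))

    asc-ibi : Asc i (conj b (conj i z))
    asc-ibi = conj-lt (conj i z) b (sw-below i) (sw-low b)
      (conj-lt z i (sw-low i) (sw-above i) bc λ (e , p , q) → n≢2+n (trans (sym p) (θ-adj z q)))
      λ (e , p , q) → let θb = trans (sw-adj i (trans (cong (λ k → sw i (θ z k)) (sym (sw-low i))) p)) (sw-high i) in
        <-asym (n<1+n i) (subst₂ _<_ (θ-adj z θb) θb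
          (lt-θ z ab (trans (cong (β z) (sym θb)) (β-θ z b))))

    asc-bib : Asc b (conj i (conj b z))
    asc-bib = conj-lt (conj b z) i (sw-high i) (sw-above i)
      (conj-lt z b (sw-below i) (sw-high b) ab λ (e , p , q) → n≢2+n (trans (sym (θ-adj z p)) q))
      λ (e , p , q) → let θb = trans (sw-adj b (trans (cong (λ k → sw b (θ z k)) (sym (sw-high b))) q)) (sw-low b) in
        <-asym (n<1+n b) (subst₂ _<_ θb (θ-adj z θb)
          (lt-θ z bc (sym (trans (cong (β z) (sym θb)) (β-θ z b)))))

    i↦b↦c : sw i (sw b c) ≡ i
    i↦b↦c = trans (cong (sw i) (sw-high b)) (sw-high i)

    i₁ : sw i (sw b i) ≡ b
    i₁ = trans (cong (sw i) (sw-below i)) (sw-low i)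

    b₁ : sw i (sw b b) ≡ c
    b₁ = trans (cong (sw i) (sw-low b)) (sw-above i)

    -- The product s_i s_b carries the pair i, b to b, c. So the third step of one route meets, up
    -- to relabelling, the pair that the other route treats first.
    nf-ibi : ¬ Fixed b z → ¬ Fixed i (conj b (conj i z))
    nf-ibi n (e , p , q) = n
      ( trans (cong (β z) (sym i₁)) (trans e (cong (β z) b₁))
      , fix-conj z i (sw-low i) (fix-conj (conj i z) b (sw-below i) p)
      , fix-conj z i (sw-above i) (fix-conj (conj i z) b (sw-low b) q))

    b₂ : sw b (sw i b) ≡ i
    b₂ = trans (cong (sw b) (sw-high i)) (sw-below i)

    c₂ : sw b (sw i c) ≡ b
    c₂ = trans (cong (sw b) (sw-above i)) (sw-high b)

    nf-bib : ¬ Fixed i z → ¬ Fixed b (conj i (conj b z))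
    nf-bib n (e , p , q) = n
      ( trans (cong (β z) (sym b₂)) (trans e (cong (β z) c₂))
      , fix-conj z b (sw-below i) (fix-conj (conj b z) i (sw-high i) p)
      , fix-conj z b (sw-high b) (fix-conj (conj b z) i (sw-above i) q))

    f-bib : Fixed i z → Fixed b (conj i (conj b z))
    f-bib (e , p , q) =
      ( trans (cong (β z) b₂) (trans e (sym (cong (β z) c₂)))
      , conj-fix (conj b z) i (sw-high i) (conj-fix z b (sw-below i) p)
      , conj-fix (conj b z) i (sw-above i) (conj-fix z b (sw-high b) q))

    f-ibi : Fixed b z → Fixed i (conj b (conj i z))
    f-ibi (e , p , q) =
      ( trans (cong (β z) i₁) (trans e (sym (cong (β z) b₁)))
      , conj-fix (conj i z) b (sw-below i) (conj-fix z i (sw-low i) p)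
      , conj-fix (conj i z) b (sw-low b) (conj-fix z i (sw-above i) q))

    link-bi : (F : Fixed i z) → Asc b (link i z F)
    link-bi F = go bc
      where
        go : lt z b c → Asc b (link i z F)
        go (inj₁ p) = inj₁ p
        go (inj₂ (e , p)) = inj₂ (e , subst₂ _<_
          (trans (sym (proj₁ (proj₂ F))) (cong (θ z) (sym (sw-high i)))) (cong (θ z) (sym (sw-above i)))
          (<-trans (n<1+n i) (subst (_< θ z c) (proj₂ (proj₂ F)) p)))

    link-ib : (F : Fixed b z) → Asc i (link b z F)
    link-ib F = go ab
      where
        go : lt z i b → Asc i (link b z F)
        go (inj₁ p) = inj₁ p
        go (inj₂ (e , p)) = inj₂ (e , subst₂ _<_
          (cong (θ z) (sym (sw-below i))) (trans (sym (proj₂ (proj₂ F))) (cong (θ z) (sym (sw-low b))))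
          (<-trans (subst (θ z i <_) (proj₁ (proj₂ F)) p) (n<1+n b)))

    link-θb : (F : Fixed i z) → θ (link i z F) b ≡ i
    link-θb F = trans (cong (θ z) (sw-high i)) (proj₁ (proj₂ F))

    link-θi : (F : Fixed i z) → θ (link i z F) i ≡ b
    link-θi F = trans (cong (θ z) (sw-low i)) (proj₂ (proj₂ F))

    link-θb′ : (F : Fixed b z) → θ (link b z F) b ≡ c
    link-θb′ F = trans (cong (θ z) (sw-low b)) (proj₂ (proj₂ F))

    link-θc : (F : Fixed b z) → θ (link b z F) c ≡ b
    link-θc F = trans (cong (θ z) (sw-high b)) (proj₁ (proj₂ F))

    nf-link-bi : (F : Fixed i z) → ¬ Fixed b (link i z F)
    nf-link-bi F (_ , p , _) = i≢b (trans (sym (link-θb F)) p)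

    nf-link-ib : (F : Fixed b z) → ¬ Fixed i (link b z F)
    nf-link-ib F (_ , _ , p) = 1+n≢n (trans (sym (link-θb′ F)) p)

  Hexagon : Set
  Hexagon = (Asc i (U b (U i z)) × Asc b (U i (U b z)) × U i (U b (U i z)) ≈ U b (U i (U b z)))

  Collapsed : Set
  Collapsed = U b (U i z) ≈ U i (U b z) × Bad i b (U b (U i z)) × (∀ u → Asc u (U b (U i z)) → Asc u z)

  private
    -- All six steps are conjugations, and the braid relation for transpositions compares the two
    -- routes.
    case-generic : ¬ Fixed i z → ¬ Fixed b z → Asc b (U i z) × Asc i (U b z) × Hexagon
    case-generic ni nb =
      lt-resp (≈-sym p₁) asc-bi , lt-resp (≈-sym q₁) asc-ib ,
      lt-resp (≈-sym p₂) asc-ibi , lt-resp (≈-sym q₂) asc-bib ,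
      ≈-trans p₃ (≈-trans (agree (λ v → cong (β z) (braid v))
        (λ v → trans (sw-braid i _) (cong (λ k → sw b (sw i (sw b (θ z k)))) (braid v)))) (≈-sym q₃))
      where
        braid : ∀ v → sw i (sw b (sw i v)) ≡ sw b (sw i (sw b v))
        braid = sw-braid i
        n : ¬ (Fixed i z × Fixed b z)
        n (f , _) = ni f
        p₁ : U i z ≈ conj i z
        p₁ = U-conj ≈-refl ab ni
        p₂ : U b (U i z) ≈ conj b (conj i z)
        p₂ = U-conj p₁ asc-bi (nf-bi n)
        p₃ : U i (U b (U i z)) ≈ conj i (conj b (conj i z))
        p₃ = U-conj p₂ asc-ibi (nf-ibi nb)
        q₁ : U b z ≈ conj b z
        q₁ = U-conj ≈-refl bc nb
        q₂ : U i (U b z) ≈ conj i (conj b z)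
        q₂ = U-conj q₁ asc-ib (nf-ib n)
        q₃ : U b (U i (U b z)) ≈ conj b (conj i (conj b z))
        q₃ = U-conj q₂ asc-bib (nf-bib ni)

    -- The route beginning with i links in its first step and the other in its last: two
    -- conjugations have moved the fixed points i, b to b, c by then.
    case-low : Fixed i z → ¬ Fixed b z → Asc b (U i z) × Asc i (U b z) × Hexagon
    case-low F@(e , fi , fb) nb =
      lt-resp (≈-sym p₁) (link-bi F) , lt-resp (≈-sym q₁) asc-ib ,
      lt-resp (≈-sym p₂) asc₂ , lt-resp (≈-sym q₂) asc-bib ,
      ≈-trans p₃ (≈-trans (agree (λ v → refl) (λ v → cong (λ k → sw i (sw b (θ z k))) (sw-braid i v))) (≈-sym q₃))
      where
        n : ¬ (Fixed i z × Fixed b z)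
        n (_ , f) = nb f
        p₁ : U i z ≈ link i z F
        p₁ = U-link ≈-refl ab F
        p₂ : U b (U i z) ≈ conj b (link i z F)
        p₂ = U-conj p₁ (link-bi F) (nf-link-bi F)
        lt-ic : lt (link i z F) i c
        lt-ic = go bc
          where
            go : lt z b c → lt (link i z F) i c
            go (inj₁ p) = inj₁ (≤-<-trans (≤-reflexive e) p)
            go (inj₂ (e′ , p)) = inj₂ (trans e e′ ,
              subst₂ _<_ (cong (θ z) (sym (sw-low i))) (cong (θ z) (sym (sw-above i))) p)
        asc₂ : Asc i (conj b (link i z F))
        asc₂ = conj-lt (link i z F) b (sw-below i) (sw-low b) lt-ic λ (e′ , _ , q) →
          nb (trans (sym e) e′ , fb , trans (cong (θ z) (sym (sw-above i))) q)
        p₃ : U i (U b (U i z)) ≈ conj i (conj b (link i z F))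
        p₃ = U-conj p₂ asc₂ λ (_ , p , _) →
          1+n≢n (trans (sym (link-θi F)) (fix-conj (link i z F) b (sw-below i) p))
        q₁ : U b z ≈ conj b z
        q₁ = U-conj ≈-refl bc nb
        q₂ : U i (U b z) ≈ conj i (conj b z)
        q₂ = U-conj q₁ asc-ib (nf-ib n)
        q₃ : U b (U i (U b z)) ≈ link b (conj i (conj b z)) (f-bib F)
        q₃ = U-link q₂ asc-bib (f-bib F)

    case-high : ¬ Fixed i z → Fixed b z → Asc b (U i z) × Asc i (U b z) × Hexagon
    case-high ni F@(e , fb , fc) =
      lt-resp (≈-sym p₁) asc-bi , lt-resp (≈-sym q₁) (link-ib F) ,
      lt-resp (≈-sym p₂) asc-ibi , lt-resp (≈-sym q₂) asc₂ ,
      ≈-trans p₃ (≈-trans (agree (λ v → refl) (λ v → cong (λ k → sw b (sw i (θ z k))) (sw-braid i v))) (≈-sym q₃))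
      where
        n : ¬ (Fixed i z × Fixed b z)
        n (f , _) = ni f
        p₁ : U i z ≈ conj i z
        p₁ = U-conj ≈-refl ab ni
        p₂ : U b (U i z) ≈ conj b (conj i z)
        p₂ = U-conj p₁ asc-bi (nf-bi n)
        p₃ : U i (U b (U i z)) ≈ link i (conj b (conj i z)) (f-ibi F)
        p₃ = U-link p₂ asc-ibi (f-ibi F)
        q₁ : U b z ≈ link b z F
        q₁ = U-link ≈-refl bc F
        q₂ : U i (U b z) ≈ conj i (link b z F)
        q₂ = U-conj q₁ (link-ib F) (nf-link-ib F)
        lt-ic : lt (link b z F) i c
        lt-ic = go ab
          where
            go : lt z i b → lt (link b z F) i c
            go (inj₁ p) = inj₁ (<-≤-trans p (≤-reflexive e))
            go (inj₂ (e′ , p)) = inj₂ (trans e′ e ,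
              subst₂ _<_ (cong (θ z) (sym (sw-below i))) (cong (θ z) (sym (sw-high b))) p)
        asc₂ : Asc b (conj i (link b z F))
        asc₂ = conj-lt (link b z F) i (sw-high i) (sw-above i) lt-ic λ (e′ , p , _) →
          ni (trans e′ (sym e) , trans (cong (θ z) (sym (sw-below i))) p , fb)
        q₃ : U b (U i (U b z)) ≈ conj b (conj i (link b z F))
        q₃ = U-conj q₂ asc₂ λ (_ , _ , p) →
          1+n≢n (sym (trans (sym (link-θc F)) (fix-conj (link b z F) i (sw-above i) p)))

    -- As for involutions of S_3: either route links two of the three fixed points and then
    -- conjugates, arriving at the 2-cycle of the outer two after only two steps.
    case-fixed : Fixed i z → Fixed b z → Asc b (U i z) × Asc i (U b z) × Collapsed
    case-fixed F@(e , fi , fb) G@(e′ , _ , fc) =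
      lt-resp (≈-sym p₁) (link-bi F) , lt-resp (≈-sym q₁) (link-ib G) ,
      ≈-trans p₂ (≈-trans (agree (λ v → trans (β-sw z b e′ v) (sym (β-sw z i e v))) θ-eq) (≈-sym q₂)) ,
      (trans (θ≡ p₂ i) θ₁i , trans (θ≡ p₂ b) θ₁b) ,
      (λ u a → below u (lt-resp p₂ a))
      where
        p₁ : U i z ≈ link i z F
        p₁ = U-link ≈-refl ab F
        p₂ : U b (U i z) ≈ conj b (link i z F)
        p₂ = U-conj p₁ (link-bi F) (nf-link-bi F)
        q₁ : U b z ≈ link b z G
        q₁ = U-link ≈-refl bc G
        q₂ : U i (U b z) ≈ conj i (link b z G)
        q₂ = U-conj q₁ (link-ib G) (nf-link-ib G)
        θ₁ θ₂ : ℕ → ℕ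
        θ₁ v = sw b (θ z (sw i (sw b v)))
        θ₂ v = sw i (θ z (sw b (sw i v)))
        θ₁i : θ₁ i ≡ c
        θ₁i = trans (cong (λ k → sw b (θ z k)) i₁) (trans (cong (sw b) fb) (sw-low b))
        θ₁b : θ₁ b ≡ b
        θ₁b = trans (cong (λ k → sw b (θ z k)) b₁) (trans (cong (sw b) fc) (sw-high b))
        θ₁c : θ₁ c ≡ i
        θ₁c = trans (cong (λ k → sw b (θ z k)) i↦b↦c) (trans (cong (sw b) fi) (sw-below i))
        outside : ∀ v → v ≢ i → v ≢ b → v ≢ c → θ z v ≢ i × θ z v ≢ b × θ z v ≢ c
        outside v p q r = (λ x → p (θ-inj z (trans x (sym fi)))) , (λ x → q (θ-inj z (trans x (sym fb)))) ,
          (λ x → r (θ-inj z (trans x (sym fc))))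
        θ₁-out : ∀ v → v ≢ i → v ≢ b → v ≢ c → θ₁ v ≡ θ z v
        θ₁-out v p q r = trans (cong (λ k → sw b (θ z k)) (trans (cong (sw i) (sw-away b q r)) (sw-away i p q)))
          (let (_ , y , w) = outside v p q r in sw-away b y w)
        θ-eq : ∀ v → θ₁ v ≡ θ₂ v
        θ-eq v with place v
        ... | at-i = trans θ₁i (sym (trans (cong (λ k → sw i (θ z k)) (trans (cong (sw b) (sw-low i)) (sw-low b)))
                                   (trans (cong (sw i) fc) (sw-above i))))
        ... | at-b = trans θ₁b (sym (trans (cong (λ k → sw i (θ z k)) b₂) (trans (cong (sw i) fi) (sw-low i))))
        ... | at-c = trans θ₁c (sym (trans (cong (λ k → sw i (θ z k)) c₂) (trans (cong (sw i) fb) (sw-high i))))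
        ... | out p q r = trans (θ₁-out v p q r) (sym
              (trans (cong (λ k → sw i (θ z k)) (trans (cong (sw b) (sw-away i p q)) (sw-away b q r)))
                (let (x , y , _) = outside v p q r in sw-away i x y)))
        -- Only the consecutive slots i, b, c are rearranged among themselves, so comparison with
        -- any slot outside them is unaffected.
        below : ∀ u → lt (conj b (link i z F)) u (suc u) → lt z u (suc u)
        below u (inj₁ p) = inj₁ (subst₂ _<_ (β-sw z b e′ u) (β-sw z b e′ (suc u)) p)
        below u (inj₂ (eβ , p)) with place u | suc u ≟ i
        ... | at-i | _ = ab
        ... | at-b | _ = bc
        ... | at-c | _ = inj₂ (eβ′ , lt-c)
          where
            eβ′ : β z c ≡ β z (suc c)
            eβ′ = trans (sym (β-sw z b e′ c)) (trans eβ (β-sw z b e′ (suc c)))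
            oc : θ z (suc c) ≢ i × θ z (suc c) ≢ b × θ z (suc c) ≢ c
            oc = outside (suc c) (λ w → <-irrefl (sym w) (m<n⇒m<1+n (m<n⇒m<1+n (n<1+n i))))
              (λ w → n≢2+n (sym w)) 1+n≢n
            i<θ : i < θ z (suc c)
            i<θ = subst₂ _<_ θ₁c (θ₁-out (suc c) (λ w → <-irrefl (sym w) (m<n⇒m<1+n (m<n⇒m<1+n (n<1+n i))))
              (λ w → n≢2+n (sym w)) 1+n≢n) p
            lt-c : θ z c < θ z (suc c)
            lt-c = subst (_< θ z (suc c)) (sym fc)
              (≤∧≢⇒< (≤∧≢⇒< i<θ (λ w → proj₁ (proj₂ oc) (sym w))) (λ w → proj₂ (proj₂ oc) (sym w)))
        ... | out x y w | yes refl = inj₂ (eβ′ , lt-i)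
          where
            eβ′ : β z u ≡ β z i
            eβ′ = trans (sym (β-sw z b e′ u)) (trans eβ (β-sw z b e′ i))
            o : θ z u ≢ i × θ z u ≢ b × θ z u ≢ c
            o = outside u x y w
            θ<c : θ z u < c
            θ<c = subst₂ _<_ (θ₁-out u x y w) θ₁i p
            lt-i : θ z u < θ z i
            lt-i = subst (θ z u <_) (sym fi) (≤∧≢⇒< (≤-pred (≤∧≢⇒< (≤-pred θ<c) (proj₁ (proj₂ o)))) (proj₁ o))
        ... | out x y w | no k = inj₂
              ( trans (sym (β-sw z b e′ u)) (trans eβ (β-sw z b e′ (suc u)))
              , subst₂ _<_ (θ₁-out u x y w)
                  (θ₁-out (suc u) k (λ q → x (suc-injective q)) (λ q → y (suc-injective q))) p)

  result : Asc b (U i z) × Asc i (U b z) × (Hexagon ⊎ Collapsed)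
  result with fixed? i z | fixed? b z
  ... | no p | no q = let (x , y , m) = case-generic p q in x , y , inj₁ m
  ... | yes p | no q = let (x , y , m) = case-low p q in x , y , inj₁ m
  ... | no p | yes q = let (x , y , m) = case-high p q in x , y , inj₁ m
  ... | yes p | yes q = let (x , y , m) = case-fixed p q in x , y , inj₂ m

-- Orbits of two commuting letters.

module FarMin {i j : ℕ} (fr : Far i j) (z : State) where
  private
    i≢j : i ≢ j
    i≢j = proj₁ fr
    si≢j : suc i ≢ j
    si≢j = proj₁ (proj₂ fr)
    sj≢i : suc j ≢ i
    sj≢i = proj₂ (proj₂ fr)
    si≢sj : suc i ≢ suc j
    si≢sj e = i≢j (suc-injective e)
    fix-j : sw i j ≡ j
    fix-j = sw-away i (λ e → i≢j (sym e)) (λ e → si≢j (sym e))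
    fix-sj : sw i (suc j) ≡ suc j
    fix-sj = sw-away i sj≢i (λ e → si≢sj (sym e))

  -- The excluded configuration of `conj-lt` at j: the only way for conjugation by s_i to destroy
  -- the ascent j.
  Crossed : Set
  Crossed = θ z j ≡ i × θ z (suc j) ≡ suc i × β z j ≡ β z (suc j)

  asc-conj : Asc j z → ¬ Crossed → Asc j (conj i z)
  asc-conj aj n = conj-lt z i fix-j fix-sj aj λ (e , p , q) → n (p , q , e)

  asc-link : Asc j z → (F : Fixed i z) → Asc j (link i z F)
  asc-link (inj₁ p) F = inj₁ p
  asc-link (inj₂ (e , p)) F = inj₂ (e , subst₂ _<_ (cong (θ z) (sym fix-j)) (cong (θ z) (sym fix-sj)) p)

  fixed-conj : Fixed j z → Fixed j (conj i z)
  fixed-conj (e , p , q) = trans (cong (β z) fix-j) (trans e (cong (β z) (sym fix-sj))) ,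
    conj-fix z i fix-j p , conj-fix z i fix-sj q

  conj-fixed : Fixed j (conj i z) → Fixed j z
  conj-fixed (e , p , q) = trans (cong (β z) (sym fix-j)) (trans e (cong (β z) fix-sj)) ,
    fix-conj z i fix-j p , fix-conj z i fix-sj q

  fixed-link : (F : Fixed i z) → Fixed j z → Fixed j (link i z F)
  fixed-link F (e , p , q) = e , trans (cong (θ z) fix-j) p , trans (cong (θ z) fix-sj) q

  link-fixed : (F : Fixed i z) → Fixed j (link i z F) → Fixed j z
  link-fixed F (e , p , q) = e , trans (cong (θ z) (sym fix-j)) p , trans (cong (θ z) (sym fix-sj)) q

  asc-U : Asc i z → Asc j z → ¬ Crossed → Asc j (U i z)
  asc-U ai aj n with fixed? i z
  ... | yes F = lt-resp (≈-sym (U-link ≈-refl ai F)) (asc-link aj F)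
  ... | no nF = lt-resp (≈-sym (U-conj ≈-refl ai nF)) (asc-conj aj n)

module _ {i j : ℕ} (fr : Far i j) (z : State) (ai : Asc i z) (aj : Asc j z) where
  private
    module I = FarMin fr z
    module J = FarMin (far-sym fr) z

    crossed : J.Crossed → I.Crossed
    crossed (p , q , e) = θ-adj z p , θ-adj z q ,
      trans (sym (cong (β z) p)) (trans (β-θ z i) (trans e (trans (sym (β-θ z (suc i))) (cong (β z) q))))

    comm-θ : ∀ v → θ z (sw i (sw j v)) ≡ θ z (sw j (sw i v))
    comm-θ v = cong (θ z) (sw-comm fr v)

  -- Acting by one letter does not change whether the other links or conjugates, so the four
  -- combinations commute separately.
  far-commute : ¬ I.Crossed → U j (U i z) ≈ U i (U j z)
  far-commute n with fixed? i z | fixed? j z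
  ... | yes F | yes G = ≈-trans
        (U-link (U-link ≈-refl ai F) (I.asc-link aj F) (I.fixed-link F G))
        (≈-trans (agree (λ v → refl) comm-θ)
        (≈-sym (U-link (U-link ≈-refl aj G) (J.asc-link ai G) (J.fixed-link G F))))
  ... | yes F | no nG = ≈-trans
        (U-conj (U-link ≈-refl ai F) (I.asc-link aj F) (λ g → nG (I.link-fixed F g)))
        (≈-trans (agree (λ v → refl) (λ v → cong (sw j) (comm-θ v)))
        (≈-sym (U-link (U-conj ≈-refl aj nG) (J.asc-conj ai (λ x → n (crossed x))) (J.fixed-conj F))))
  ... | no nF | yes G = ≈-trans
        (U-link (U-conj ≈-refl ai nF) (I.asc-conj aj n) (I.fixed-conj G))
        (≈-trans (agree (λ v → refl) (λ v → cong (sw i) (comm-θ v)))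
        (≈-sym (U-conj (U-link ≈-refl aj G) (J.asc-link ai G) (λ f → nF (J.link-fixed G f)))))
  ... | no nF | no nG = ≈-trans
        (U-conj (U-conj ≈-refl ai nF) (I.asc-conj aj n) (λ g → nG (I.conj-fixed g)))
        (≈-trans (agree (λ v → cong (β z) (sw-comm fr v))
          (λ v → trans (cong (λ k → sw j (sw i k)) (comm-θ v)) (sym (sw-comm fr _))))
        (≈-sym (U-conj (U-conj ≈-refl aj nG) (J.asc-conj ai (λ x → n (crossed x))) (λ f → nF (J.conj-fixed f)))))

  -- Here θ carries s_i to s_j, so both letters conjugate z in the same way.
  far-crossed : I.Crossed → U i z ≈ U j z × Bad i j (U i z) × ∃ λ u → u ≢ i × u ≢ j × ¬ Asc u (U i z)
  far-crossed (p , q , e) =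
    ≈-trans y≈ (≈-trans (agree (λ v → trans (β-sw z i eᵢ v) (sym (β-sw z j e v))) θ-eq)
      (≈-sym (U-conj ≈-refl aj λ (_ , f , _) → i≢j (trans (sym p) f)))) ,
    (trans (θ≡ y≈ i) yi , trans (θ≡ y≈ (suc i)) ysi) ,
    third
    where
      i≢j : i ≢ j
      i≢j = proj₁ fr
      y : State
      y = conj i z
      p′ : θ z i ≡ j
      p′ = θ-adj z p
      q′ : θ z (suc i) ≡ suc j
      q′ = θ-adj z q
      ij : β z i ≡ β z j
      ij = trans (sym (cong (β z) p)) (β-θ z j)
      eᵢ : β z i ≡ β z (suc i)
      eᵢ = trans ij (trans e (trans (sym (β-θ z (suc j))) (cong (β z) q)))
      y≈ : U i z ≈ y
      y≈ = U-conj ≈-refl ai λ (_ , f , _) → i≢j (trans (sym f) p′)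
      swap-θ : ∀ v → θ z (sw i v) ≡ sw j (θ z v)
      swap-θ v with sw i v | sw-view i v
      ... | _ | low = trans q′ (sym (trans (cong (sw j) p′) (sw-low j)))
      ... | _ | high = trans p′ (sym (trans (cong (sw j) q′) (sw-high j)))
      ... | _ | away a b = sym (sw-away j (λ x → a (θ-inj z (trans x (sym p′)))) (λ x → b (θ-inj z (trans x (sym q′)))))
      swap-θ′ : ∀ v → θ z (sw j v) ≡ sw i (θ z v)
      swap-θ′ v = sym (trans (sym (θ-invol z _))
        (cong (θ z) (trans (swap-θ (θ z v)) (cong (sw j) (θ-invol z v)))))
      θ-eq : ∀ v → sw i (θ z (sw i v)) ≡ sw j (θ z (sw j v))
      θ-eq v = trans (cong (sw i) (swap-θ v)) (trans (sw-comm fr _) (sym (cong (sw j) (swap-θ′ v))))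
      yi : θ y i ≡ suc j
      yi = trans (cong (λ k → sw i (θ z k)) (sw-low i)) (trans (cong (sw i) q′)
             (sw-away i (proj₂ (proj₂ fr)) (λ x → i≢j (sym (suc-injective x)))))
      ysi : θ y (suc i) ≡ j
      ysi = trans (cong (λ k → sw i (θ z k)) (sw-high i)) (trans (cong (sw i) p′)
             (sw-away i (λ x → i≢j (sym x)) (λ x → proj₁ (proj₂ fr) (sym x))))
      yj : θ y j ≡ suc i
      yj = θ-adj y ysi
      ysj : θ y (suc j) ≡ i
      ysj = θ-adj y yi
      βy : ∀ v → β y v ≡ β z v
      βy = β-sw z i eᵢ
      -- In y the involution exchanges i + 1 with j and i with j + 1. If i < j, then j is written
      -- before i + 1, which forces a descent u with i + 1 ≤ u < j; the other case is symmetric.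
      third : ∃ λ u → u ≢ i × u ≢ j × ¬ Asc u (U i z)
      third with <-cmp i j
      ... | tri≈ _ x _ = ⊥-elim (i≢j x)
      ... | tri< i<j _ _ with between y {suc i} {j} (≤∧≢⇒< i<j (proj₁ (proj₂ fr)))
              (inj₂ (trans (βy j) (trans (sym ij) (trans eᵢ (sym (βy (suc i))))) ,
                subst₂ _<_ (sym yj) (sym ysi) (≤∧≢⇒< i<j (proj₁ (proj₂ fr)))))
      ...   | u , l , h , nu = u , (λ x → <-irrefl (sym x) l) , (λ x → <-irrefl x h) , λ a → nu (lt-resp y≈ a)
      third | tri> _ _ j<i with between y {suc j} {i} (≤∧≢⇒< j<i (proj₂ (proj₂ fr)))
              (inj₂ (trans (βy i) (trans ij (trans e (sym (βy (suc j))))) ,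
                subst₂ _<_ (sym yi) (sym ysj) (≤∧≢⇒< j<i (proj₂ (proj₂ fr)))))
      ...   | u , l , h , nu = u , (λ x → <-irrefl x h) , (λ x → <-irrefl (sym x) l) , λ a → nu (lt-resp y≈ a)

U-near : ∀ {s t} z → Near s t → Asc s z → Asc t z →
  Asc t (U s z) ×
  ((Asc s (U t (U s z)) × U s (U t (U s z)) ≈ U t (U s (U t z))) ⊎
   (U t (U s z) ≈ U s (U t z) × Bad s t (U t (U s z)) ×
    (∀ u → ¬ Asc u z → ¬ Asc u (U t (U s z)))))
U-near {s} z (inj₁ refl) as at with NearMin.result s z as at
... | a , _ , inj₁ (b , _ , eq) = a , inj₁ (b , eq)
... | a , _ , inj₂ (eq , bad , d) = a , inj₂ (eq , bad , λ u na a → na (d u a))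
U-near {t = t} z (inj₂ refl) as at with NearMin.result t z at as
... | _ , a , inj₁ (_ , b , eq) = a , inj₁ (b , ≈-sym eq)
... | _ , a , inj₂ (eq , bad , d) =
      a , inj₂ (≈-sym eq , Bad-sym {M = U t (U (suc t) z)} (Bad-resp eq bad) , λ u na a → na (d u (lt-resp (≈-sym eq) a)))

U-far : ∀ {s t} z → Far s t → Asc s z → Asc t z →
  (Asc t (U s z) × U t (U s z) ≈ U s (U t z)) ⊎
  (U s z ≈ U t z × Bad s t (U s z) × ∃ λ u → u ≢ s × u ≢ t × ¬ Asc u (U s z))
U-far {s} {t} z fr as at with (θ z t ≟ s) ×-dec ((θ z (suc t) ≟ suc s) ×-dec (β z t ≟ β z (suc t)))
... | yes c = inj₂ (far-crossed fr z as at c)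
... | no n = inj₁ (FarMin.asc-U fr z as at n , far-commute fr z as at n)

μ-action : (e : State) → (∀ s → Asc s e) → LocalAction
μ-action e Asc-e = record
  { X = State
  ; _≈_ = _≈_
  ; ≈-equiv = record { refl = ≈-refl ; sym = ≈-sym ; trans = ≈-trans }
  ; e = e
  ; U = U
  ; Asc = Asc
  ; asc? = asc?
  ; Bad = Bad
  ; U-cong = U-cong
  ; Asc-resp = λ _ p → lt-resp p
  ; Bad-resp = Bad-resp
  ; U-desc = U-desc
  ; U-asc = U-asc
  ; U-inj = U-inj
  ; Asc-e = Asc-e
  ; Bad-sym = λ {_} {_} {M} → Bad-sym {M = M}
  ; Bad-unique = λ (p , _) (q , _) → suc-injective (trans (sym q) p)
  ; far = U-far
  ; near = U-near
  }

-- Lengths and Hecke products in one-line notation.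

module _ {P A : Set} {x y : A} where

  if-yes : (d : Dec P) → P → (if ⌊ d ⌋ then x else y) ≡ x
  if-yes (yes _) _ = refl
  if-yes (no n) p = ⊥-elim (n p)

  if-no : (d : Dec P) → ¬ P → (if ⌊ d ⌋ then x else y) ≡ y
  if-no (yes p) n = ⊥-elim (n p)
  if-no (no _) _ = refl

swapVal-map : ∀ i w → swapVal i w ≡ map (sw i) w
swapVal-map i = map-cong (sw-def i)

cnt : ℕ → List ℕ → ℕ
cnt k w = length (filter (λ y → y <? k) w)

module _ {k x : ℕ} (w : List ℕ) where

  cnt-yes : x < k → cnt k (x ∷ w) ≡ suc (cnt k w)
  cnt-yes p = cong length (filter-accept (λ y → y <? k) p)

  cnt-no : ¬ x < k → cnt k (x ∷ w) ≡ cnt k w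
  cnt-no n = cong length (filter-reject (λ y → y <? k) n)

cnt-map : ∀ {k l} (f : ℕ → ℕ) w → (∀ {x} → x ∈ w → (x < k → f x < l) × (f x < l → x < k)) →
          cnt l (map f w) ≡ cnt k w
cnt-map f [] h = refl
cnt-map {k} {l} f (x ∷ w) h with x <? k
... | yes p = trans (cnt-yes (map f w) (proj₁ (h (here refl)) p))
                (trans (cong suc (cnt-map f w (h ∘ there))) (sym (cnt-yes w p)))
... | no n = trans (cnt-no (map f w) (n ∘ proj₂ (h (here refl))))
                (trans (cnt-map f w (h ∘ there)) (sym (cnt-no w n)))

StrictOn : (ℕ → ℕ) → List ℕ → Set
StrictOn f w = ∀ {x y} → x ∈ w → y ∈ w → x < y → f x < f y

strict-reflects : ∀ {f w} → StrictOn f w → ∀ {x y} → x ∈ w → y ∈ w → f x < f y → x < y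
strict-reflects {f} s {x} {y} p q l with <-cmp x y
... | tri< a _ _ = a
... | tri≈ _ refl _ = ⊥-elim (<-irrefl refl l)
... | tri> _ _ c = ⊥-elim (<-asym l (s q p c))

len-map : ∀ {f} w → StrictOn f w → len (map f w) ≡ len w
len-map [] s = refl
len-map {f} (x ∷ w) s = cong₂ _+_
  (cnt-map f w λ y → (s (there y) (here refl)) , strict-reflects s (there y) (here refl))
  (len-map w λ p q → s (there p) (there q))

cnt-suc-∉ : ∀ {i} w → i ∉ w → cnt (suc i) w ≡ cnt i w
cnt-suc-∉ [] _ = refl
cnt-suc-∉ {i} (x ∷ w) n with x <? i
... | yes p = trans (cnt-yes w (m≤n⇒m≤1+n p)) (trans (cong suc (cnt-suc-∉ w (n ∘ there))) (sym (cnt-yes w p)))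
... | no q = trans (cnt-no w (λ p → q (≤∧≢⇒< (≤-pred p) (λ e → n (here (sym e))))))
               (trans (cnt-suc-∉ w (n ∘ there)) (sym (cnt-no w q)))

head∉ : ∀ {x : ℕ} {w} → Unique (x ∷ w) → x ∉ w
head∉ (p ∷ _) q = All.lookup p q refl

cnt-suc-∈ : ∀ {i} w → Unique w → i ∈ w → cnt (suc i) w ≡ suc (cnt i w)
cnt-suc-∈ {i} (.i ∷ w) u (here refl) = trans (cnt-yes w (n<1+n i))
  (cong suc (trans (cnt-suc-∉ w (head∉ u)) (sym (cnt-no w (<-irrefl refl)))))
cnt-suc-∈ {i} (x ∷ w) (q ∷ u) (there p) with x <? i
... | yes r = trans (cnt-yes w (m≤n⇒m≤1+n r)) (cong suc (trans (cnt-suc-∈ w u p) (sym (cnt-yes w r))))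
... | no r = trans (cnt-no w (λ s → r (≤∧≢⇒< (≤-pred s) (All.lookup q p))))
               (trans (cnt-suc-∈ w u p) (cong suc (sym (cnt-no w r))))

data Before (x y : ℕ) : List ℕ → Set where
  here : ∀ {w} → y ∈ w → Before x y (x ∷ w)
  there : ∀ {z w} → Before x y w → Before x y (z ∷ w)

before-∈ : ∀ {x y w} → Before x y w → x ∈ w × y ∈ w
before-∈ (here p) = here refl , there p
before-∈ (there b) = there (proj₁ (before-∈ b)) , there (proj₂ (before-∈ b))

before-map : ∀ f {x y w} → Before x y w → Before (f x) (f y) (map f w)
before-map f (here p) = here (∈-map⁺ f p)
before-map f (there b) = there (before-map f b)

before-++ˡ : ∀ {x y v w} → Before x y v → Before x y (v ++ w)
before-++ˡ (here p) = here (∈-++⁺ˡ p)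
before-++ˡ (there b) = there (before-++ˡ b)

before-++ʳ : ∀ {x y} v {w} → Before x y w → Before x y (v ++ w)
before-++ʳ [] b = b
before-++ʳ (_ ∷ v) b = there (before-++ʳ v b)

before-++ : ∀ {x y v w} → x ∈ v → y ∈ w → Before x y (v ++ w)
before-++ {v = _ ∷ v} (here refl) q = here (∈-++⁺ʳ v q)
before-++ (there p) q = there (before-++ p q)

before-sorted : ∀ {x y w} → AllPairs _<_ w → x ∈ w → y ∈ w → x < y → Before x y w
before-sorted (q ∷ s) (here refl) (here refl) l = ⊥-elim (<-irrefl refl l)
before-sorted (q ∷ s) (here refl) (there p) l = here p
before-sorted (q ∷ s) (there p) (here refl) l = ⊥-elim (<-asym l (All.lookup q p))
before-sorted (q ∷ s) (there p) (there r) l = there (before-sorted s p r l)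

sw-inj : ∀ i {x y} → sw i x ≡ sw i y → x ≡ y
sw-inj i {x} {y} e = trans (sym (sw-invol i x)) (trans (cong (sw i) e) (sw-invol i y))

sw-strict : ∀ i {w} → i ∉ w → StrictOn (sw i) w
sw-strict i n p q l = sw-mono i l (λ { (refl , _) → n p })

-- Unless the threshold z equals i + 1, both i and i + 1 lie on the same side of it.
sw-<⁺ : ∀ i {x z} → z ≢ suc i → x < z → sw i x < z
sw-<⁺ i {x} {z} n l with sw i x | sw-view i x
... | _ | low = ≤∧≢⇒< l (n ∘ sym)
... | _ | high = <⇒≤ l
... | _ | away _ _ = l

sw-<⁻ : ∀ i {x z} → z ≢ suc i → sw i x < z → x < z
sw-<⁻ i {x} {z} n l = subst (_< z) (sw-invol i x) (sw-<⁺ i n l)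

cnt-sw : ∀ i {z} w → z ≢ suc i → cnt z (map (sw i) w) ≡ cnt z w
cnt-sw i w n = cnt-map (sw i) w (λ _ → sw-<⁺ i n , sw-<⁻ i n)

unique-sw : ∀ i {w} → Unique w → Unique (map (sw i) w)
unique-sw i = UniqueP.map⁺ (sw-inj i)

-- The pair i, i + 1 becomes the one new inversion: counts from any other letter are unchanged, and
-- the letter i, now i + 1, gains the former i + 1 behind it.
len-sw : ∀ i {w} → Unique w → Before i (suc i) w → len (map (sw i) w) ≡ suc (len w)
len-sw i {.i ∷ w} u@(_ ∷ u′) (here p) = cong₂ _+_
  (trans (cong (λ k → cnt k (map (sw i) w)) (sw-low i))
    (trans (cnt-suc-∈ (map (sw i) w) (unique-sw i u′) (subst (_∈ map (sw i) w) (sw-high i) (∈-map⁺ (sw i) p)))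
      (cong suc (cnt-sw i w (λ e → 1+n≢n (sym e))))))
  (len-map w (sw-strict i (head∉ u)))
len-sw i {z ∷ w} u@(_ ∷ u′) (there b) = trans (cong₂ _+_
  (trans (cong (λ k → cnt k (map (sw i) w)) (sw-away i z≢i z≢si)) (cnt-sw i w z≢si))
  (len-sw i u′ b)) (+-suc (cnt z w) (len w))
  where
    z≢i : z ≢ i
    z≢i refl = head∉ u (proj₁ (before-∈ b))
    z≢si : z ≢ suc i
    z≢si refl = head∉ u (proj₂ (before-∈ b))

heckeL-asc : ∀ i {w} → Unique w → Before i (suc i) w → heckeL i w ≡ map (sw i) w
heckeL-asc i {w} u b = trans (if-yes (len w <? len (swapVal i w))
  (≤-reflexive (sym (trans (cong len (swapVal-map i w)) (len-sw i u b))))) (swapVal-map i w)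

heckeL-desc : ∀ i {w} → Unique w → Before (suc i) i w → heckeL i w ≡ w
heckeL-desc i {w} u b = if-no (len w <? len (swapVal i w)) λ l →
  <-asym (subst (len w <_) (cong len (swapVal-map i w)) l) (≤-reflexive (sym len-eq))
  where
    len-eq : len w ≡ suc (len (map (sw i) w))
    len-eq = trans (cong len (sym (trans (sym (map-∘ w)) (trans (map-cong (sw-invol i) w) (map-id w)))))
      (len-sw i (unique-sw i u)
        (subst₂ (λ x y → Before x y (map (sw i) w)) (sw-high i) (sw-low i) (before-map (sw i) b)))

swapPos-++ : ∀ v {x y w} → swapPos (suc (length v)) (v ++ x ∷ y ∷ w) ≡ v ++ y ∷ x ∷ w
swapPos-++ [] = refl
swapPos-++ (z ∷ v) = cong (z ∷_) (swapPos-++ v)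

cnt-cons : ∀ k x {v w} → cnt k v ≡ cnt k w → cnt k (x ∷ v) ≡ cnt k (x ∷ w)
cnt-cons k x {v} {w} e with x <? k
... | yes p = trans (cnt-yes v p) (trans (cong suc e) (sym (cnt-yes w p)))
... | no n = trans (cnt-no v n) (trans e (sym (cnt-no w n)))

cnt-transpose : ∀ k v {x y w} → cnt k (v ++ x ∷ y ∷ w) ≡ cnt k (v ++ y ∷ x ∷ w)
cnt-transpose k [] {x} {y} {w} with x <? k | y <? k
... | yes p | yes q = trans (cnt-yes _ p) (trans (cong suc (cnt-yes w q))
                        (sym (trans (cnt-yes _ q) (cong suc (cnt-yes w p)))))
... | yes p | no q = trans (cnt-yes _ p) (trans (cong suc (cnt-no w q)) (sym (trans (cnt-no _ q) (cnt-yes w p))))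
... | no p | yes q = trans (cnt-no _ p) (trans (cnt-yes w q) (sym (trans (cnt-yes _ q) (cong suc (cnt-no w p)))))
... | no p | no q = trans (cnt-no _ p) (trans (cnt-no w q) (sym (trans (cnt-no _ q) (cnt-no w p))))
cnt-transpose k (z ∷ v) = cnt-cons k z (cnt-transpose k v)

len-transpose : ∀ v {x y w} → x < y → len (v ++ y ∷ x ∷ w) ≡ suc (len (v ++ x ∷ y ∷ w))
len-transpose [] {x} {y} {w} l = begin
  cnt y (x ∷ w) + (cnt x w + len w)       ≡⟨ cong (_+ (cnt x w + len w)) (cnt-yes w l) ⟩
  suc (cnt y w + (cnt x w + len w))       ≡⟨ cong suc (sym (+-assoc (cnt y w) (cnt x w) (len w))) ⟩
  suc (cnt y w + cnt x w + len w)         ≡⟨ cong (λ k → suc (k + len w)) (+-comm (cnt y w) (cnt x w)) ⟩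
  suc (cnt x w + cnt y w + len w)         ≡⟨ cong suc (+-assoc (cnt x w) (cnt y w) (len w)) ⟩
  suc (cnt x w + (cnt y w + len w))       ≡⟨ cong (λ k → suc (k + (cnt y w + len w))) (sym (cnt-no w (<-asym l))) ⟩
  suc (cnt x (y ∷ w) + (cnt y w + len w)) ∎
  where open ≡-Reasoning
len-transpose (z ∷ v) {x} {y} {w} l = trans
  (cong₂ _+_ (cnt-transpose z v) (len-transpose v l)) (+-suc (cnt z (v ++ x ∷ y ∷ w)) _)

heckeR-asc : ∀ v {x y w} → x < y → heckeR (v ++ x ∷ y ∷ w) (suc (length v)) ≡ v ++ y ∷ x ∷ w
heckeR-asc v {x} {y} {w} l = trans
  (if-yes (len (v ++ x ∷ y ∷ w) <? len (swapPos (suc (length v)) (v ++ x ∷ y ∷ w)))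
    (≤-reflexive (sym (trans (cong len (swapPos-++ v)) (len-transpose v l)))))
  (swapPos-++ v)

heckeR-desc : ∀ v {x y w} → y < x → heckeR (v ++ x ∷ y ∷ w) (suc (length v)) ≡ v ++ x ∷ y ∷ w
heckeR-desc v {x} {y} {w} l =
  if-no (len (v ++ x ∷ y ∷ w) <? len (swapPos (suc (length v)) (v ++ x ∷ y ∷ w))) λ p →
    <-asym (subst (len (v ++ x ∷ y ∷ w) <_) (cong len (swapPos-++ v)) p) (≤-reflexive (sym (len-transpose v l)))

cnt-mono : ∀ {k l} w → k ≤ l → cnt k w ≤ cnt l w
cnt-mono [] _ = z≤n
cnt-mono {k} {l} (x ∷ w) h with x <? k | x <? l
... | yes p | yes q = subst₂ _≤_ (sym (cnt-yes w p)) (sym (cnt-yes w q)) (s≤s (cnt-mono w h))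
... | yes p | no q = ⊥-elim (q (<-≤-trans p h))
... | no p | yes q = subst₂ _≤_ (sym (cnt-no w p)) (sym (cnt-yes w q)) (m≤n⇒m≤1+n (cnt-mono w h))
... | no p | no q = subst₂ _≤_ (sym (cnt-no w p)) (sym (cnt-no w q)) (cnt-mono w h)

rank-strict : ∀ {B} → Unique B → StrictOn (rank B) B
rank-strict {B} u p _ l = s≤s (≤-trans (≤-reflexive (sym (cnt-suc-∈ B u p))) (cnt-mono B l))

strict-inj : ∀ {f w} → StrictOn f w → ∀ {x y} → x ∈ w → y ∈ w → f x ≡ f y → x ≡ y
strict-inj s {x} {y} p q e with <-cmp x y
... | tri< a _ _ = ⊥-elim (<-irrefl e (s p q a))
... | tri≈ _ a _ = a
... | tri> _ _ a = ⊥-elim (<-irrefl (sym e) (s q p a))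

strict-⊆ : ∀ {f v w} → (∀ {x} → x ∈ v → x ∈ w) → StrictOn f w → StrictOn f v
strict-⊆ h s p q = s (h p) (h q)

at-filter : ∀ {P : ℕ → Set} (P? : Decidable P) w {x} → x ∈ w → P x → (∀ {y} → y ∈ w → P y → y ≡ x) →
            at (filter P? w) 1 ≡ x
at-filter P? (y ∷ w) {x} m px h with P? y
... | yes py = h (here refl) py
... | no ny = at-filter P? w (tail m) px (h ∘ there)
  where
    tail : x ∈ y ∷ w → x ∈ w
    tail (here refl) = ⊥-elim (ny px)
    tail (there q) = q

valOfRank-rank : ∀ {B} → Unique B → ∀ {x} → x ∈ B → valOfRank B (rank B x) ≡ x
valOfRank-rank {B} u {x} p = at-filter (λ y → rank B y ≟ rank B x) B p refl
  (λ q e → strict-inj (rank-strict u) q p e)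

select-map : ∀ {a b a′ b′} (f : ℕ → ℕ) v w → a ≡ a′ → b ≡ b′ →
  (if ⌊ a <? b ⌋ then map f v else map f w) ≡ map f (if ⌊ a′ <? b′ ⌋ then v else w)
select-map {a} {b} f v w refl refl with ⌊ a <? b ⌋
... | true = refl
... | false = refl

if-∈ : ∀ b {v w : List ℕ} {x} → x ∈ (if b then v else w) → x ∈ v ⊎ x ∈ w
if-∈ true p = inj₁ p
if-∈ false p = inj₂ p

swapPos-map : ∀ f k w → swapPos k (map f w) ≡ map f (swapPos k w)
swapPos-map f zero [] = refl
swapPos-map f zero (_ ∷ _) = refl
swapPos-map f (suc zero) [] = refl
swapPos-map f (suc zero) (_ ∷ []) = refl
swapPos-map f (suc zero) (_ ∷ _ ∷ _) = refl
swapPos-map f (suc (suc k)) [] = refl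
swapPos-map f (suc (suc k)) (x ∷ w) = cong (f x ∷_) (swapPos-map f (suc k) w)

swapPos-∈ : ∀ k w {x} → x ∈ swapPos k w → x ∈ w
swapPos-∈ zero [] p = p
swapPos-∈ zero (_ ∷ _) p = p
swapPos-∈ (suc zero) [] p = p
swapPos-∈ (suc zero) (_ ∷ []) p = p
swapPos-∈ (suc zero) (_ ∷ _ ∷ _) (here e) = there (here e)
swapPos-∈ (suc zero) (_ ∷ _ ∷ _) (there (here e)) = here e
swapPos-∈ (suc zero) (_ ∷ _ ∷ _) (there (there p)) = there (there p)
swapPos-∈ (suc (suc k)) [] p = p
swapPos-∈ (suc (suc k)) (x ∷ w) (here e) = here e
swapPos-∈ (suc (suc k)) (x ∷ w) (there p) = there (swapPos-∈ (suc k) w p)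

sw-∈ : ∀ {i B x} → i ∈ B → suc i ∈ B → x ∈ B → sw i x ∈ B
sw-∈ {i} {x = x} p q r with sw i x | sw-view i x
... | _ | low = q
... | _ | high = p
... | _ | away _ _ = r

-- Standardization is an order isomorphism, so the Hecke products defining newBlock may be
-- computed on the block itself.
newBlock-hecke : ∀ {i B} → Unique B → i ∈ B → suc i ∈ B →
  newBlock i B ≡ heckeR (heckeL i B) (rank B i)
newBlock-hecke {i} {B} u p q = begin
  map (valOfRank B) (heckeR (heckeL r (map φ B)) r) ≡⟨ cong (λ w → map (valOfRank B) (heckeR w r)) eqL ⟩
  map (valOfRank B) (heckeR (map φ C) r)            ≡⟨ cong (map (valOfRank B)) eqR ⟩
  map (valOfRank B) (map φ (heckeR C r))            ≡⟨ sym (map-∘ (heckeR C r)) ⟩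
  map (λ x → valOfRank B (φ x)) (heckeR C r)        ≡⟨ map-id-local (All.tabulate λ m → valOfRank-rank u (D⊆B m)) ⟩
  heckeR C r                                        ∎
  where
    open ≡-Reasoning
    r : ℕ
    r = rank B i
    φ : ℕ → ℕ
    φ = rank B
    C : List ℕ
    C = heckeL i B
    φs : StrictOn φ B
    φs = rank-strict u
    φ-suc : φ (suc i) ≡ suc r
    φ-suc = cong suc (cnt-suc-∈ B u p)
    S⊆B : ∀ {x} → x ∈ swapVal i B → x ∈ B
    S⊆B {x} m with ∈-map⁻ (sw i) (subst (x ∈_) (swapVal-map i B) m)
    ... | y , y∈ , refl = sw-∈ p q y∈
    C⊆B : ∀ {x} → x ∈ C → x ∈ B
    C⊆B m with if-∈ ⌊ len B <? len (swapVal i B) ⌋ m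
    ... | inj₁ a = S⊆B a
    ... | inj₂ a = a
    D⊆B : ∀ {x} → x ∈ heckeR C r → x ∈ B
    D⊆B m with if-∈ ⌊ len C <? len (swapPos r C) ⌋ m
    ... | inj₁ a = C⊆B (swapPos-∈ r C a)
    ... | inj₂ a = C⊆B a
    φ-sw : ∀ {x} → x ∈ B → sw r (φ x) ≡ φ (sw i x)
    φ-sw {x} m with sw i x | sw-view i x
    ... | _ | low = trans (sw-low r) (sym φ-suc)
    ... | _ | high = trans (cong (sw r) φ-suc) (sw-high r)
    ... | _ | away a b = sw-away r (λ e → a (strict-inj φs m p e)) (λ e → b (strict-inj φs m q (trans e (sym φ-suc))))
    swap-φ : swapVal r (map φ B) ≡ map φ (swapVal i B)
    swap-φ = trans (swapVal-map r (map φ B)) (trans (sym (map-∘ B))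
      (trans (map-cong-local (All.tabulate φ-sw)) (trans (map-∘ B) (cong (map φ) (sym (swapVal-map i B))))))
    eqL : heckeL r (map φ B) ≡ map φ C
    eqL = trans (cong (λ w → if ⌊ len (map φ B) <? len w ⌋ then w else map φ B) swap-φ)
      (select-map φ (swapVal i B) B (len-map B φs) (len-map (swapVal i B) (strict-⊆ S⊆B φs)))
    eqR : heckeR (map φ C) r ≡ map φ (heckeR C r)
    eqR = trans (cong (λ w → if ⌊ len (map φ C) <? len w ⌋ then w else map φ C) (swapPos-map φ r C))
      (select-map φ (swapPos r C) C (len-map C (strict-⊆ C⊆B φs))
        (len-map (swapPos r C) (strict-⊆ (C⊆B ∘ swapPos-∈ r C) φs)))

-- Intervals a + 1, ..., a + k, membership tests and cutting into blocks.

rng : ℕ → ℕ → List ℕ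
rng a zero = []
rng a (suc k) = suc a ∷ rng (suc a) k

rng-++ : ∀ a k l → rng a (k + l) ≡ rng a k ++ rng (a + k) l
rng-++ a zero l = cong (λ b → rng b l) (sym (+-identityʳ a))
rng-++ a (suc k) l = cong (suc a ∷_) (trans (rng-++ (suc a) k l) (cong (λ b → rng (suc a) k ++ rng b l) (sym (+-suc a k))))

rng-∈⁻ : ∀ a k {v} → v ∈ rng a k → a < v × v ≤ a + k
rng-∈⁻ a (suc k) (here refl) = ≤-refl , subst (suc a ≤_) (sym (+-suc a k)) (s≤s (m≤m+n a k))
rng-∈⁻ a (suc k) {v} (there p) with rng-∈⁻ (suc a) k p
... | q , r = <⇒≤ q , subst (v ≤_) (sym (+-suc a k)) r

rng-∈⁺ : ∀ a k {v} → a < v → v ≤ a + k → v ∈ rng a k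
rng-∈⁺ a zero {v} p q = ⊥-elim (<-irrefl refl (<-≤-trans p (subst (v ≤_) (+-identityʳ a) q)))
rng-∈⁺ a (suc k) {v} p q with suc a ≟ v
... | yes refl = here refl
... | no n = there (rng-∈⁺ (suc a) k (≤∧≢⇒< p n) (subst (v ≤_) (+-suc a k) q))

rng-sorted : ∀ a k → AllPairs _<_ (rng a k)
rng-sorted a zero = []
rng-sorted a (suc k) = All.tabulate (λ p → proj₁ (rng-∈⁻ (suc a) k p)) ∷ rng-sorted (suc a) k

idPerm-rng : ∀ n → idPerm n ≡ rng 0 n
idPerm-rng n = go (λ x → x) 0 n (λ _ → refl)
  where
    go : ∀ f a k → (∀ x → f x ≡ a + x) → map suc (applyUpTo f k) ≡ rng a k
    go f a zero h = refl
    go f a (suc k) h = cong₂ _∷_ (cong suc (trans (h 0) (+-identityʳ a)))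
      (go (λ x → f (suc x)) (suc a) k (λ x → trans (h (suc x)) (+-suc a x)))

sorted⇒unique : ∀ {w} → AllPairs _<_ w → Unique w
sorted⇒unique = AllPairs.map (λ p e → <-irrefl e p)

filter-fixing : ∀ {P Q : ℕ → Set} (P? : Decidable P) (Q? : Decidable Q) f w →
  (∀ {v} → v ∈ w → f v ≡ v × (P v → Q v) × (Q v → P v)) → filter Q? w ≡ map f (filter P? w)
filter-fixing P? Q? f [] h = refl
filter-fixing P? Q? f (v ∷ w) h with P? v
... | yes p = trans (filter-accept Q? (proj₁ (proj₂ (h (here refl))) p))
                (cong₂ _∷_ (sym (proj₁ (h (here refl)))) (filter-fixing P? Q? f w (h ∘ there)))
... | no n = trans (filter-reject Q? (n ∘ proj₂ (proj₂ (h (here refl))))) (filter-fixing P? Q? f w (h ∘ there))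

isYes-yes : ∀ {P : Set} (d : Dec P) → P → ⌊ d ⌋ ≡ true
isYes-yes (yes _) _ = refl
isYes-yes (no n) p = ⊥-elim (n p)

isYes-no : ∀ {P : Set} (d : Dec P) → ¬ P → ⌊ d ⌋ ≡ false
isYes-no (yes p) n = ⊥-elim (n p)
isYes-no (no _) _ = refl

mem-yes : ∀ {v B} → v ∈ B → mem v B ≡ true
mem-yes {v} {_ ∷ B} (here refl) = cong (_∨ mem v B) (isYes-yes (v ≟ v) refl)
mem-yes {v} {x ∷ B} (there p) = trans (cong (⌊ x ≟ v ⌋ ∨_) (mem-yes p)) (∨-zeroʳ ⌊ x ≟ v ⌋)

mem-no : ∀ {v} B → v ∉ B → mem v B ≡ false
mem-no [] n = refl
mem-no {v} (x ∷ B) n = cong₂ _∨_ (isYes-no (x ≟ v) (λ e → n (here (sym e)))) (mem-no B (n ∘ there))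

blocks-concat : ∀ {μ} Bs → map length Bs ≡ μ → blocks μ (concat Bs) ≡ Bs
blocks-concat [] refl = refl
blocks-concat (B ∷ Bs) refl = cong₂ _∷_ (take-length B)
  (trans (cong (blocks (map length Bs)) (drop-length B)) (blocks-concat Bs refl))
  where
    take-length : ∀ (v : List ℕ) {w} → take (length v) (v ++ w) ≡ v
    take-length [] = refl
    take-length (x ∷ v) = cong (x ∷_) (take-length v)
    drop-length : ∀ (v : List ℕ) {w} → drop (length v) (v ++ w) ≡ w
    drop-length [] = refl
    drop-length (x ∷ v) = drop-length v

past-head : ∀ {b r k} → b < r + suc k → b < suc r + k
past-head {b} {r} {k} = subst (b <_) (+-suc r k)

-- Decoding states into one-line notation.

module Decode (n : ℕ) where

  InRange : ℕ → Set
  InRange v = 1 ≤ v × v ≤ n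

  Closed : State → Set
  Closed M = ∀ v → ¬ InRange v → θ M v ≡ v

  blk : State → ℕ → List ℕ
  blk M r = filter (λ v → β M v ≟ r) (rng 0 n)

  -- The list `blk M r` is increasing, so applying θ entrywise produces the letters of the block in
  -- order.
  word : State → ℕ → List ℕ
  word M r = map (θ M) (blk M r)

  blk-∈⁻ : ∀ M {r v} → v ∈ blk M r → InRange v × β M v ≡ r
  blk-∈⁻ M p with ∈-filter⁻ (λ v → β M v ≟ _) {xs = rng 0 n} p
  ... | q , e = rng-∈⁻ 0 n q , e

  blk-∈⁺ : ∀ M {r v} → InRange v → β M v ≡ r → v ∈ blk M r
  blk-∈⁺ M (p , q) e = ∈-filter⁺ (λ v → β M v ≟ _) (rng-∈⁺ 0 n p q) e

  blk-sorted : ∀ M r → AllPairs _<_ (blk M r)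
  blk-sorted M r = AllPairsP.filter⁺ (λ v → β M v ≟ r) (rng-sorted 0 n)

  blk-cong : ∀ {M N} → (∀ v → β M v ≡ β N v) → ∀ r → blk M r ≡ blk N r
  blk-cong {M} {N} e r = filter-≐ (λ v → β M v ≟ r) (λ v → β N v ≟ r)
    ((λ {v} p → trans (sym (e v)) p) , (λ {v} p → trans (e v) p)) (rng 0 n)

  word-cong : ∀ {M N} → M ≈ N → ∀ r → word M r ≡ word N r
  word-cong {M} {N} (agree p q) r = trans (map-cong q (blk M r)) (cong (map (θ N)) (blk-cong {M} {N} p r))

  θ-range : ∀ M → Closed M → ∀ {v} → InRange v → InRange (θ M v)
  θ-range M c {v} p with (1 ≤? θ M v) | (θ M v ≤? n)
  ... | yes a | yes b = a , b
  ... | no a | _ = subst InRange (sym (trans (sym (c _ (a ∘ proj₁))) (θ-invol M v))) p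
  ... | yes _ | no b = subst InRange (sym (trans (sym (c _ (b ∘ proj₂))) (θ-invol M v))) p

  word-∈⁻ : ∀ M → Closed M → ∀ {r v} → v ∈ word M r → InRange v × β M v ≡ r
  word-∈⁻ M c p with ∈-map⁻ (θ M) p
  ... | x , q , refl with blk-∈⁻ M q
  ...   | i , e = θ-range M c i , trans (β-θ M x) e

  word-∈⁺ : ∀ M → Closed M → ∀ {r v} → InRange v → β M v ≡ r → v ∈ word M r
  word-∈⁺ M c {r} {v} i e = subst (_∈ word M r) (θ-invol M v)
    (∈-map⁺ (θ M) (blk-∈⁺ M (θ-range M c i) (trans (β-θ M v) e)))

  word-unique : ∀ M r → Unique (word M r)
  word-unique M r = UniqueP.map⁺ (θ-inj M) (sorted⇒unique (blk-sorted M r))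

  word↭blk : ∀ M → Closed M → ∀ r → word M r ↭ blk M r
  word↭blk M c r = ∼bag⇒↭ (unique∧set⇒bag (word-unique M r) (sorted⇒unique (blk-sorted M r))
    (mk⇔ (λ p → let (i , e) = word-∈⁻ M c p in blk-∈⁺ M i e) (λ p → let (i , e) = blk-∈⁻ M p in word-∈⁺ M c i e)))

  word-before : ∀ M → Closed M → ∀ {r x y} → InRange x → InRange y → β M x ≡ r → β M y ≡ r →
                θ M x < θ M y → Before x y (word M r)
  word-before M c {r} {x} {y} ix iy ex ey l = subst₂ (λ a b → Before a b (word M r)) (θ-invol M x) (θ-invol M y)
    (before-map (θ M) (before-sorted (blk-sorted M r)
      (blk-∈⁺ M (θ-range M c ix) (trans (β-θ M x) ex)) (blk-∈⁺ M (θ-range M c iy) (trans (β-θ M y) ey)) l))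

  module _ (M : State) (i′ k : ℕ) (n≡ : n ≡ i′ + (2 + k)) where
    private
      i : ℕ
      i = suc i′

    rng-split : rng 0 n ≡ rng 0 i′ ++ i ∷ suc i ∷ rng (suc i) k
    rng-split = trans (cong (rng 0) n≡) (rng-++ 0 i′ (2 + k))

    Below Above : ℕ → List ℕ
    Below r = filter (λ v → β M v ≟ r) (rng 0 i′)
    Above r = filter (λ v → β M v ≟ r) (rng (suc i) k)

    below-< : ∀ {r v} → v ∈ Below r → v < i
    below-< {r} p = s≤s (proj₂ (rng-∈⁻ 0 i′ (proj₁ (∈-filter⁻ (λ v → β M v ≟ r) {xs = rng 0 i′} p))))

    above-> : ∀ {r v} → v ∈ Above r → suc i < v
    above-> {r} p = proj₁ (rng-∈⁻ (suc i) k (proj₁ (∈-filter⁻ (λ v → β M v ≟ r) {xs = rng (suc i) k} p)))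

    blk-split : ∀ {r} → β M i ≡ r → β M (suc i) ≡ r → blk M r ≡ Below r ++ i ∷ suc i ∷ Above r
    blk-split {r} p q = trans (cong (filter P?) rng-split) (trans (filter-++ P? (rng 0 i′) _)
      (cong (Below r ++_) (trans (filter-accept P? p) (cong (i ∷_) (filter-accept P? q)))))
      where
        P? : Decidable (λ v → β M v ≡ r)
        P? v = β M v ≟ r

    -- Ranks ignore the order of the letters and can be counted in the sorted block, where exactly
    -- `Below r` precedes i.
    rank-word : ∀ {r} → Closed M → β M i ≡ r → β M (suc i) ≡ r → rank (word M r) i ≡ suc (length (Below r))
    rank-word {r} c p q = cong suc (begin
      cnt i (word M r)                            ≡⟨ ↭-length (filter-↭ (λ y → y <? i) (word↭blk M c r)) ⟩
      cnt i (blk M r)                             ≡⟨ cong (cnt i) (blk-split p q) ⟩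
      cnt i (Below r ++ i ∷ suc i ∷ Above r)      ≡⟨ cong length (filter-++ (λ y → y <? i) (Below r) _) ⟩
      length (filter (λ y → y <? i) (Below r) ++ filter (λ y → y <? i) (i ∷ suc i ∷ Above r))
        ≡⟨ cong₂ (λ v w → length (v ++ w))
             (filter-all (λ y → y <? i) (All.tabulate (below-< {r})))
             (filter-none (λ y → y <? i) (<-irrefl refl ∷ (λ l → <-asym l (n<1+n i)) ∷
               All.tabulate λ m l → <-asym l (<-trans (n<1+n i) (above-> {r} m)))) ⟩
      length (Below r ++ [])                      ≡⟨ cong length (++-identityʳ (Below r)) ⟩
      length (Below r)                            ∎)
      where open ≡-Reasoning

    iR : InRange i
    iR = s≤s z≤n , subst (i ≤_) (sym (trans n≡ (+-suc i′ (suc k)))) (s≤s (m≤m+n i′ (suc k)))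

    sR : InRange (suc i)
    sR = s≤s z≤n , subst (suc i ≤_) (sym (trans n≡ (trans (+-suc i′ (suc k)) (cong suc (+-suc i′ k))))) (s≤s (s≤s (m≤m+n i′ k)))

    -- Left and right ascents of an involution agree, so at a descent both factors are idle. At an
    -- ascent the left factor acts; the right one then meets a descent precisely when i and i + 1
    -- were fixed, which separates `link` from `conj`.
    newBlock-word : ∀ {r} → Closed M → β M i ≡ r → β M (suc i) ≡ r → newBlock i (word M r) ≡ word (U i M) r
    newBlock-word {r} c p q = trans
      (newBlock-hecke (word-unique M r) (word-∈⁺ M c iR p) (word-∈⁺ M c sR q))
      (trans (cong (heckeR (heckeL i (word M r))) (rank-word c p q)) (go (asc? i M)))
      where
        pos : ℕ
        pos = suc (length (Below r))
        split-map : ∀ f → map f (blk M r) ≡ map f (Below r) ++ f i ∷ f (suc i) ∷ map f (Above r)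
        split-map f = trans (cong (map f) (blk-split p q)) (map-++ f (Below r) _)
        R-asc : ∀ f → f i < f (suc i) → heckeR (map f (blk M r)) pos ≡ map f (Below r) ++ f (suc i) ∷ f i ∷ map f (Above r)
        R-asc f l = trans (cong₂ heckeR (split-map f) (cong suc (sym (length-map f (Below r))))) (heckeR-asc (map f (Below r)) l)
        R-desc : ∀ f → f (suc i) < f i → heckeR (map f (blk M r)) pos ≡ map f (blk M r)
        R-desc f l = trans (cong₂ heckeR (split-map f) (cong suc (sym (length-map f (Below r)))))
          (trans (heckeR-desc (map f (Below r)) l) (sym (split-map f)))
        L-asc : Asc i M → heckeL i (word M r) ≡ map (λ v → sw i (θ M v)) (blk M r)
        L-asc a = trans (heckeL-asc i (word-unique M r) (word-before M c iR sR p q (lt-θ M a (trans p (sym q)))))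
          (sym (map-∘ (blk M r)))
        go : Dec (Asc i M) → heckeR (heckeL i (word M r)) pos ≡ word (U i M) r
        go (no d) = trans (cong (λ w → heckeR w pos) (heckeL-desc i (word-unique M r) (word-before M c sR iR q p l)))
          (trans (R-desc (θ M) l) (word-cong (≈-sym (U-desc i d)) r))
          where
            l : θ M (suc i) < θ M i
            l with <-cmp (θ M i) (θ M (suc i))
            ... | tri< a _ _ = ⊥-elim (d (inj₂ (trans p (sym q) , a)))
            ... | tri≈ _ a _ = ⊥-elim (1+n≢n (sym (θ-inj M a)))
            ... | tri> _ _ a = a
        go (yes a) with fixed? i M
        ... | yes F@(_ , f , g) = trans (cong (λ w → heckeR w pos) (L-asc a))
              (trans (R-desc (λ v → sw i (θ M v))
                (subst₂ _<_ (sym (trans (cong (sw i) g) (sw-high i))) (sym (trans (cong (sw i) f) (sw-low i))) (n<1+n i)))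
              (trans (map-cong (λ v → sym (θ-sw M i F v)) (blk M r)) (word-cong (≈-sym (U-link ≈-refl a F)) r)))
        ... | no nF = trans (cong (λ w → heckeR w pos) (L-asc a))
              (trans (R-asc (λ v → sw i (θ M v)) (sw-mono i (lt-θ M a pq) (λ (f , g) → nF (pq , f , g))))
              (trans (cong₂ _++_ (map-cong-local (All.tabulate λ m → cong g (sym (sw-away i (<⇒≢ (below-< {r} m)) (<⇒≢ (m<n⇒m<1+n (below-< {r} m)))))))
                        (cong₂ _∷_ (cong g (sym (sw-low i))) (cong₂ _∷_ (cong g (sym (sw-high i)))
                        (map-cong-local (All.tabulate λ m → cong g (sym (sw-away i
                          (λ e → <-asym (n<1+n i) (subst (suc i <_) e (above-> {r} m))) (λ e → <-irrefl (sym e) (above-> {r} m)))))))))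
              (trans (sym (split-map (θ (conj i M))))
              (trans (cong (map (θ (conj i M))) (blk-cong {M} {conj i M} (λ v → sym (β-sw M i pq v)) r))
                (word-cong (≈-sym (U-conj ≈-refl a nF)) r)))))
          where
            pq : β M i ≡ β M (suc i)
            pq = trans p (sym q)
            g : ℕ → ℕ
            g v = sw i (θ M v)

    -- A block contains at most one of i and i + 1, so relabelling keeps its list of values sorted.
    blk-conj : ∀ r → β M i ≢ β M (suc i) → blk (conj i M) r ≡ map (sw i) (blk M r)
    blk-conj r ne = begin
      filter Q? (rng 0 n)                                    ≡⟨ cong (filter Q?) rng-split ⟩
      filter Q? (rng 0 i′ ++ i ∷ suc i ∷ rng (suc i) k)      ≡⟨ filter-++ Q? (rng 0 i′) _ ⟩
      filter Q? (rng 0 i′) ++ filter Q? (i ∷ suc i ∷ rng (suc i) k)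
        ≡⟨ cong₂ _++_ (same (rng 0 i′) (λ m → <⇒≢ (s≤s (proj₂ (rng-∈⁻ 0 i′ m))) , <⇒≢ (m<n⇒m<1+n (s≤s (proj₂ (rng-∈⁻ 0 i′ m))))))
            (mid (β M i ≟ r) (β M (suc i) ≟ r)) ⟩
      map (sw i) (filter P? (rng 0 i′)) ++ map (sw i) (filter P? (i ∷ suc i ∷ rng (suc i) k))
        ≡⟨ sym (map-++ (sw i) (filter P? (rng 0 i′)) _) ⟩
      map (sw i) (filter P? (rng 0 i′) ++ filter P? (i ∷ suc i ∷ rng (suc i) k))
        ≡⟨ cong (map (sw i)) (sym (filter-++ P? (rng 0 i′) _)) ⟩
      map (sw i) (filter P? (rng 0 i′ ++ i ∷ suc i ∷ rng (suc i) k)) ≡⟨ cong (λ w → map (sw i) (filter P? w)) (sym rng-split) ⟩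
      map (sw i) (filter P? (rng 0 n)) ∎
      where
        open ≡-Reasoning
        P? : Decidable (λ v → β M v ≡ r)
        P? v = β M v ≟ r
        Q? : Decidable (λ v → β M (sw i v) ≡ r)
        Q? v = β M (sw i v) ≟ r
        same : ∀ w → (∀ {v} → v ∈ w → v ≢ i × v ≢ suc i) → filter Q? w ≡ map (sw i) (filter P? w)
        same w h = filter-fixing P? Q? (sw i) w λ m → let sv = uncurry (sw-away i) (h m) in
          sv , trans (cong (β M) sv) , trans (cong (β M) (sym sv))
        R : List ℕ
        R = rng (suc i) k
        rest : filter Q? R ≡ map (sw i) (filter P? R)
        rest = same R λ m → (λ e → <-asym (n<1+n i) (subst (suc i <_) e (proj₁ (rng-∈⁻ (suc i) k m)))) ,
          (λ e → <-irrefl (sym e) (proj₁ (rng-∈⁻ (suc i) k m)))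
        qi : ∀ {x} → β M (suc i) ≡ x → β M (sw i i) ≡ x
        qi = trans (cong (β M) (sw-low i))
        qs : ∀ {x} → β M i ≡ x → β M (sw i (suc i)) ≡ x
        qs = trans (cong (β M) (sw-high i))
        mid : Dec (β M i ≡ r) → Dec (β M (suc i) ≡ r) →
              filter Q? (i ∷ suc i ∷ R) ≡ map (sw i) (filter P? (i ∷ suc i ∷ R))
        mid (yes a) (yes b) = ⊥-elim (ne (trans a (sym b)))
        mid (yes a) (no b) = trans (filter-reject Q? (λ z → b (trans (sym (qi refl)) z)))
          (trans (filter-accept Q? (qs a)) (trans (cong₂ _∷_ (sym (sw-low i)) rest)
          (cong (map (sw i)) (sym (trans (filter-accept P? a) (cong (i ∷_) (filter-reject P? b)))))))
        mid (no a) (yes b) = trans (filter-accept Q? (qi b))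
          (trans (cong (i ∷_) (filter-reject Q? (λ z → a (trans (sym (qs refl)) z)))) (trans (cong₂ _∷_ (sym (sw-high i)) rest)
          (cong (map (sw i)) (sym (trans (filter-reject P? a) (filter-accept P? b))))))
        mid (no a) (no b) = trans (filter-reject Q? (λ z → b (trans (sym (qi refl)) z)))
          (trans (filter-reject Q? (λ z → a (trans (sym (qs refl)) z))) (trans rest
          (cong (map (sw i)) (sym (trans (filter-reject P? a) (filter-reject P? b))))))

    word-conj : ∀ r → β M i ≢ β M (suc i) → word (conj i M) r ≡ map (sw i) (word M r)
    word-conj r ne = begin
      map (θ (conj i M)) (blk (conj i M) r)         ≡⟨ cong (map (θ (conj i M))) (blk-conj r ne) ⟩
      map (θ (conj i M)) (map (sw i) (blk M r))     ≡⟨ sym (map-∘ (blk M r)) ⟩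
      map (λ v → sw i (θ M (sw i (sw i v)))) (blk M r) ≡⟨ map-cong (λ v → cong (λ x → sw i (θ M x)) (sw-invol i v)) (blk M r) ⟩
      map (λ v → sw i (θ M v)) (blk M r)            ≡⟨ map-∘ (blk M r) ⟩
      map (sw i) (word M r)                         ∎
      where open ≡-Reasoning

  decodeBlocks : List ℕ → ℕ → State → List (List ℕ)
  decodeBlocks [] r M = []
  decodeBlocks (_ ∷ μ) r M = word M r ∷ decodeBlocks μ (suc r) M

  decodeBlocks-cong : ∀ {M N} μ r → (∀ s → word M s ≡ word N s) → decodeBlocks μ r M ≡ decodeBlocks μ r N
  decodeBlocks-cong [] r h = refl
  decodeBlocks-cong (_ ∷ μ) r h = cong₂ _∷_ (h r) (decodeBlocks-cong μ (suc r) h)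

  decode : List ℕ → State → List ℕ
  decode μ M = concat (decodeBlocks μ 0 M)

  decode-cong : ∀ μ {M N} → M ≈ N → decode μ M ≡ decode μ N
  decode-cong μ p = cong concat (decodeBlocks-cong μ 0 (word-cong p))

  module _ {M : State} (c : Closed M) where

    decode-∈⁻ : ∀ μ {r v} → v ∈ concat (decodeBlocks μ r M) → r ≤ β M v
    decode-∈⁻ (_ ∷ μ) {r} p with ∈-++⁻ (word M r) p
    ... | inj₁ q = ≤-reflexive (sym (proj₂ (word-∈⁻ M c q)))
    ... | inj₂ q = <⇒≤ (decode-∈⁻ μ q)

    decode-∈⁺ : ∀ μ {r v} → InRange v → r ≤ β M v → β M v < r + length μ → v ∈ concat (decodeBlocks μ r M)
    decode-∈⁺ [] {r} i l h = ⊥-elim (<-irrefl refl (≤-<-trans l (subst (_ <_) (+-identityʳ r) h)))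
    decode-∈⁺ (_ ∷ μ) {r} {v} i l h with β M v ≟ r
    ... | yes e = ∈-++⁺ˡ (word-∈⁺ M c i e)
    ... | no n = ∈-++⁺ʳ (word M r) (decode-∈⁺ μ i (≤∧≢⇒< l (n ∘ sym)) (past-head h))

    decode-unique : ∀ μ r → Unique (concat (decodeBlocks μ r M))
    decode-unique [] r = []
    decode-unique (_ ∷ μ) r = UniqueP.++⁺ (word-unique M r) (decode-unique μ (suc r))
      λ (p , q) → <-irrefl (sym (proj₂ (word-∈⁻ M c p))) (decode-∈⁻ μ q)

    decode-before : ∀ μ {r x y} → InRange x → InRange y → r ≤ β M x → β M x < β M y → β M y < r + length μ →
                    Before x y (concat (decodeBlocks μ r M))
    decode-before [] {r} _ _ l m h = ⊥-elim (<-irrefl refl (≤-<-trans (≤-trans l (<⇒≤ m)) (subst (_ <_) (+-identityʳ r) h)))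
    decode-before (_ ∷ μ) {r} {x} ix iy l m h with β M x ≟ r
    ... | yes refl = before-++ (word-∈⁺ M c ix refl) (decode-∈⁺ μ iy m (past-head h))
    ... | no n = before-++ʳ (word M r) (decode-before μ ix iy (≤∧≢⇒< l (n ∘ sym)) m (past-head h))

  -- The invariant that makes decoding faithful: `sizes` lets `blocks μ` recover the blocks from
  -- their concatenation, while `closed` and `outside` pin the state down off [n], where the list
  -- shows nothing but `≈` still compares.
  record Fits (μ : List ℕ) (e M : State) : Set where
    field
      closed : Closed M
      inside : ∀ {v} → InRange v → β M v < length μ
      outside : ∀ {v} → ¬ InRange v → β M v ≡ β e v
      sizes : map length (decodeBlocks μ 0 M) ≡ μ
  open Fits

  module _ {M : State} (i′ k : ℕ) (n≡ : n ≡ i′ + (2 + k)) (c : Closed M) where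
    private
      i : ℕ
      i = suc i′
      iI : InRange i
      iI = iR M i′ k n≡
      sI : InRange (suc i)
      sI = sR M i′ k n≡

    both-in : List ℕ → Bool
    both-in B = mem i B ∧ mem (suc i) B

    any-same : ∀ μ r → β M i ≡ β M (suc i) → r ≤ β M i → β M i < r + length μ → any both-in (decodeBlocks μ r M) ≡ true
    any-same [] r e l h = ⊥-elim (<-irrefl refl (≤-<-trans l (subst (_ <_) (+-identityʳ r) h)))
    any-same (_ ∷ μ) r e l h with β M i ≟ r
    ... | yes q = cong (_∨ any both-in (decodeBlocks μ (suc r) M))
          (cong₂ _∧_ (mem-yes (word-∈⁺ M c iI q)) (mem-yes (word-∈⁺ M c sI (trans (sym e) q))))
    ... | no n = trans (cong (both-in (word M r) ∨_) (any-same μ (suc r) e (≤∧≢⇒< l (n ∘ sym)) (past-head h)))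
          (∨-zeroʳ (both-in (word M r)))

    any-different : ∀ μ r → β M i ≢ β M (suc i) → any both-in (decodeBlocks μ r M) ≡ false
    any-different [] r ne = refl
    any-different (_ ∷ μ) r ne = cong₂ _∨_ (head (β M i ≟ r)) (any-different μ (suc r) ne)
      where
        head : Dec (β M i ≡ r) → both-in (word M r) ≡ false
        head (yes e) = trans (cong (mem i (word M r) ∧_)
          (mem-no (word M r) λ p → ne (trans e (sym (proj₂ (word-∈⁻ M c p)))))) (∧-zeroʳ (mem i (word M r)))
        head (no ne′) = cong (_∧ mem (suc i) (word M r)) (mem-no (word M r) λ p → ne′ (proj₂ (word-∈⁻ M c p)))

    word-U-other : ∀ r → β M i ≡ β M (suc i) → β M i ≢ r → word M r ≡ word (U i M) r
    word-U-other r e ne with asc? i M | fixed? i M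
    ... | no d | _ = word-cong (≈-sym (U-desc i d)) r
    ... | yes a | yes F = trans (map-cong-local (All.tabulate λ m → cong (θ M) (sym (fix m)))) (word-cong (≈-sym (U-link ≈-refl a F)) r)
      where
        fix : ∀ {v} → v ∈ blk M r → sw i v ≡ v
        fix m = sw-away i (λ { refl → ne (proj₂ (blk-∈⁻ M m)) }) (λ { refl → ne (trans e (proj₂ (blk-∈⁻ M m))) })
    ... | yes a | no nF = trans (cong (map (θ M)) (blk-cong {M} {conj i M} (λ v → sym (β-sw M i e v)) r))
          (trans (map-cong-local (All.tabulate λ {v} m → sym (fix (trans (sym (β-sw M i e v)) (proj₂ (blk-∈⁻ (conj i M) m))))))
            (word-cong (≈-sym (U-conj ≈-refl a nF)) r))
      where
        away-r : ∀ {v} → β M v ≡ r → sw i v ≡ v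
        away-r b = sw-away i (λ { refl → ne b }) (λ { refl → ne (trans e b) })
        fix : ∀ {v} → β M v ≡ r → sw i (θ M (sw i v)) ≡ θ M v
        fix {v} b = trans (cong (λ x → sw i (θ M x)) (away-r b)) (away-r (trans (β-θ M v) b))

    update-same : ∀ μ r → β M i ≡ β M (suc i) →
      map (λ B → if mem i B then newBlock i B else B) (decodeBlocks μ r M) ≡ decodeBlocks μ r (U i M)
    update-same [] r e = refl
    update-same (_ ∷ μ) r e = cong₂ _∷_ (head (β M i ≟ r)) (update-same μ (suc r) e)
      where
        B : List ℕ
        B = word M r
        head : Dec (β M i ≡ r) → (if mem i B then newBlock i B else B) ≡ word (U i M) r
        head (yes q) = trans (cong (if_then newBlock i B else B) (mem-yes (word-∈⁺ M c iI q)))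
          (newBlock-word M i′ k n≡ c q (trans (sym e) q))
        head (no q) = trans (cong (if_then newBlock i B else B) (mem-no B λ p → q (proj₂ (word-∈⁻ M c p))))
          (word-U-other r e q)

    decode-conj : ∀ μ r → β M i ≢ β M (suc i) →
      concat (decodeBlocks μ r (conj i M)) ≡ map (sw i) (concat (decodeBlocks μ r M))
    decode-conj [] r ne = refl
    decode-conj (_ ∷ μ) r ne = trans (cong₂ _++_ (word-conj M i′ k n≡ r ne) (decode-conj μ (suc r) ne))
      (sym (map-++ (sw i) (word M r) _))

    -- The test in `step` decides β i = β (i + 1). For different blocks an ascent is just a
    -- comparison of block indices, and the left Hecke product relabels the whole word.
    step-decode : ∀ μ {e} → Fits μ e M → step μ (decode μ M) i ≡ decode μ (U i M)
    step-decode μ F = trans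
      (cong (λ Bs → if any both-in Bs then concat (map (λ B → if mem i B then newBlock i B else B) Bs) else heckeL i (decode μ M))
        (blocks-concat (decodeBlocks μ 0 M) (sizes F)))
      (go (β M i ≟ β M (suc i)))
      where
        upd : List (List ℕ)
        upd = map (λ B → if mem i B then newBlock i B else B) (decodeBlocks μ 0 M)
        u : Unique (decode μ M)
        u = decode-unique c μ 0
        go : Dec (β M i ≡ β M (suc i)) →
          (if any both-in (decodeBlocks μ 0 M) then concat upd else heckeL i (decode μ M)) ≡ decode μ (U i M)
        go (yes e) = trans (cong (if_then concat upd else heckeL i (decode μ M)) (any-same μ 0 e z≤n (inside F iI)))
          (cong concat (update-same μ 0 e))
        go (no ne) = trans (cong (if_then concat upd else heckeL i (decode μ M)) (any-different μ 0 ne)) (apply (asc? i M))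
          where
            apply : Dec (Asc i M) → heckeL i (decode μ M) ≡ decode μ (U i M)
            apply (yes a@(inj₂ (e , _))) = ⊥-elim (ne e)
            apply (yes a@(inj₁ l)) = trans (heckeL-asc i u (decode-before c μ iI sI z≤n l (inside F sI)))
              (trans (sym (decode-conj μ 0 ne)) (decode-cong μ (≈-sym (U-conj ≈-refl a (λ f → ne (proj₁ f))))))
            apply (no d) = trans (heckeL-desc i u (decode-before c μ sI iI z≤n
                (≤∧≢⇒< (≮⇒≥ (d ∘ inj₁)) (ne ∘ sym)) (inside F iI)))
              (decode-cong μ (≈-sym (U-desc i d)))

    private
      out-fixed : ∀ {v} → ¬ InRange v → sw i v ≡ v
      out-fixed nv = sw-away i (λ { refl → nv iI }) (λ { refl → nv sI })

      sw-range : ∀ {v} → InRange v → InRange (sw i v)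
      sw-range {v} iv with sw i v | sw-view i v
      ... | _ | low = sI
      ... | _ | high = iI
      ... | _ | away _ _ = iv

    word-length-conj : ∀ r → length (word (conj i M) r) ≡ length (word M r)
    word-length-conj r with β M i ≟ β M (suc i)
    ... | no ne = trans (cong length (word-conj M i′ k n≡ r ne)) (length-map (sw i) (word M r))
    ... | yes e = trans (length-map _ (blk (conj i M) r))
          (trans (cong length (blk-cong {conj i M} {M} (β-sw M i e) r)) (sym (length-map _ (blk M r))))

    word-length-U : ∀ r → length (word (U i M) r) ≡ length (word M r)
    word-length-U r with asc? i M | fixed? i M
    ... | no d | _ = cong length (word-cong (U-desc i d) r)
    ... | yes a | yes F = trans (cong length (word-cong (U-link ≈-refl a F) r))
          (trans (length-map _ (blk M r)) (sym (length-map _ (blk M r))))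
    ... | yes a | no nF = trans (cong length (word-cong (U-conj ≈-refl a nF) r)) (word-length-conj r)

    sizes-U : ∀ μ r → map length (decodeBlocks μ r (U i M)) ≡ map length (decodeBlocks μ r M)
    sizes-U [] r = refl
    sizes-U (_ ∷ μ) r = cong₂ _∷_ (word-length-U r) (sizes-U μ (suc r))

    fits-U : ∀ {μ e} → Fits μ e M → Fits μ e (U i M)
    fits-U {μ} {e} F = record
      { closed = λ v nv → trans (θ≡ v≈ v) (cl nv)
      ; inside = λ {v} iv → subst (_< length μ) (sym (β≡ v≈ v)) (ins iv)
      ; outside = λ {v} nv → trans (β≡ v≈ v) (out nv)
      ; sizes = trans (sizes-U μ 0) (sizes F)
      }
      where
        Shape : State → Set
        Shape N = (∀ {v} → ¬ InRange v → θ N v ≡ v) × (∀ {v} → InRange v → β N v < length μ) ×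
                  (∀ {v} → ¬ InRange v → β N v ≡ β e v)
        shape : ∃ λ N → U i M ≈ N × Shape N
        shape with asc? i M | fixed? i M
        ... | no d | _ = M , U-desc i d , (λ nv → closed F _ nv) , inside F , outside F
        ... | yes a | yes f = link i M f , U-link ≈-refl a f ,
              (λ nv → trans (cong (θ M) (out-fixed nv)) (closed F _ nv)) , inside F , outside F
        ... | yes a | no nf = conj i M , U-conj ≈-refl a nf ,
              (λ nv → trans (cong (λ x → sw i (θ M x)) (out-fixed nv)) (trans (cong (sw i) (closed F _ nv)) (out-fixed nv))) ,
              (λ iv → inside F (sw-range iv)) ,
              (λ nv → trans (cong (β M) (out-fixed nv)) (outside F nv))
        v≈ = proj₁ (proj₂ shape)
        cl = proj₁ (proj₂ (proj₂ shape))
        ins = proj₁ (proj₂ (proj₂ (proj₂ shape)))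
        out = proj₂ (proj₂ (proj₂ (proj₂ shape)))

  decodeBlocks-at : ∀ {M N} μ {r s} → decodeBlocks μ r M ≡ decodeBlocks μ r N → r ≤ s → s < r + length μ → word M s ≡ word N s
  decodeBlocks-at [] {r} e l h = ⊥-elim (<-irrefl refl (≤-<-trans l (subst (_ <_) (+-identityʳ r) h)))
  decodeBlocks-at (_ ∷ μ) {r} {s} e l h with r ≟ s
  ... | yes refl = proj₁ (∷-injective e)
  ... | no n = decodeBlocks-at μ (proj₂ (∷-injective e)) (≤∧≢⇒< l n) (past-head h)

  -- Membership in the recovered blocks determines β, and comparing letters slot by slot determines
  -- θ.
  decode-injective : ∀ {μ e M N} → Fits μ e M → Fits μ e N → decode μ M ≡ decode μ N → M ≈ N
  decode-injective {μ} {e} {M} {N} F G eq = agree β-eq θ-eq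
    where
      blocks-eq : decodeBlocks μ 0 M ≡ decodeBlocks μ 0 N
      blocks-eq = trans (sym (blocks-concat _ (sizes F))) (trans (cong (blocks μ) eq) (blocks-concat _ (sizes G)))
      words-eq : ∀ {v} → InRange v → word M (β M v) ≡ word N (β M v)
      words-eq iv = decodeBlocks-at μ blocks-eq z≤n (inside F iv)
      inRange? : ∀ v → Dec (InRange v)
      inRange? v = (1 ≤? v) ×-dec (v ≤? n)
      β-eq : ∀ v → β M v ≡ β N v
      β-eq v with inRange? v
      ... | no nv = trans (outside F nv) (sym (outside G nv))
      ... | yes iv = sym (proj₂ (word-∈⁻ N (closed G) (subst (v ∈_) (words-eq iv) (word-∈⁺ M (closed F) iv refl))))
      map-agree : ∀ w {v} → map (θ M) w ≡ map (θ N) w → v ∈ w → θ M v ≡ θ N v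
      map-agree (_ ∷ w) e (here refl) = proj₁ (∷-injective e)
      map-agree (_ ∷ w) e (there p) = map-agree w (proj₂ (∷-injective e)) p
      θ-eq : ∀ v → θ M v ≡ θ N v
      θ-eq v with inRange? v
      ... | no nv = trans (closed F v nv) (sym (closed G v nv))
      ... | yes iv = map-agree (blk M (β M v))
            (trans (words-eq iv) (cong (map (θ N)) (blk-cong {N} {M} (λ x → sym (β-eq x)) (β M v))))
            (blk-∈⁺ M iv refl)

-- The state of the identity permutation.

-- Junk values: length μ for v > sum μ, and 0 for v = 0.
blockIndex : List ℕ → ℕ → ℕ
blockIndex [] v = 0
blockIndex (k ∷ μ) v with v ≤? k
... | yes _ = 0
... | no _ = suc (blockIndex μ (v ∸ k))

blockIndex-yes : ∀ {k} μ {v} → v ≤ k → blockIndex (k ∷ μ) v ≡ 0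
blockIndex-yes {k} μ {v} p with v ≤? k
... | yes _ = refl
... | no n = ⊥-elim (n p)

blockIndex-no : ∀ {k} μ {v} → ¬ v ≤ k → blockIndex (k ∷ μ) v ≡ suc (blockIndex μ (v ∸ k))
blockIndex-no {k} μ {v} n with v ≤? k
... | yes p = ⊥-elim (n p)
... | no _ = refl

blockIndex-mono : ∀ μ {v w} → v ≤ w → blockIndex μ v ≤ blockIndex μ w
blockIndex-mono [] l = z≤n
blockIndex-mono (k ∷ μ) {v} {w} l with v ≤? k | w ≤? k
... | yes _ | _ = z≤n
... | no n | yes p = ⊥-elim (n (≤-trans l p))
... | no _ | no _ = s≤s (blockIndex-mono μ (∸-monoˡ-≤ k l))

blockIndex-< : ∀ μ {v} → 1 ≤ v → v ≤ sum μ → blockIndex μ v < length μ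
blockIndex-< [] l h = ⊥-elim (<-irrefl refl (≤-trans l h))
blockIndex-< (k ∷ μ) {v} l h with v ≤? k
... | yes _ = s≤s z≤n
... | no n = s≤s (blockIndex-< μ (m<n⇒0<n∸m (≰⇒> n)) (≤-trans (∸-monoˡ-≤ k h) (≤-reflexive (m+n∸m≡n k (sum μ)))))

initial : List ℕ → State
initial μ = record { β = blockIndex μ ; θ = λ v → v ; θ-invol = λ _ → refl ; β-θ = λ _ → refl }

-- Letters of the abstract action are unbounded, so the junk values too must keep the block index
-- monotone.
initial-asc : ∀ μ s → Asc s (initial μ)
initial-asc μ s with m≤n⇒m<n∨m≡n (blockIndex-mono μ (n≤1+n s))
... | inj₁ l = inj₁ l
... | inj₂ e = inj₂ (e , n<1+n s)

module _ {P : ℕ → Set} (P? : Decidable P) where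

  filter-middle : ∀ u v w → (∀ {x} → x ∈ u → ¬ P x) → (∀ {x} → x ∈ v → P x) → (∀ {x} → x ∈ w → ¬ P x) →
                  filter P? (u ++ v ++ w) ≡ v
  filter-middle u v w hu hv hw = trans (filter-++ P? u (v ++ w))
    (trans (cong₂ _++_ (filter-none P? (All.tabulate hu)) (filter-++ P? v w))
    (trans (cong₂ _++_ (filter-all P? (All.tabulate hv)) (filter-none P? (All.tabulate hw))) (++-identityʳ v)))

module _ {X Y A : Set} (f : Y → A → Y) (g : X → A → X) (d : X → Y) (G : X → Set) {P : A → Set}
  (simulates : ∀ {x a} → P a → G x → f (d x) a ≡ d (g x a) × G (g x a)) where

  foldl-simulation : ∀ as {x} → All P as → G x → foldl f (d x) as ≡ d (foldl g x as) × G (foldl g x as)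
  foldl-simulation [] [] h = refl , h
  foldl-simulation (a ∷ as) (p ∷ ps) h with simulates p h
  ... | eq , h′ with foldl-simulation as ps h′
  ...   | eq′ , h″ = trans (cong (λ y → foldl f y as) eq) eq′ , h″

-- The action on lists simulated by the action on states.

module Simulation (n : ℕ) (ν : List ℕ) (sum-ν : sum ν ≡ n) where
  open Decode n
  open Exchange (μ-action (initial ν) (initial-asc ν)) hiding (_⊙_)

  -- Induction over the suffixes μ of ν: the first r blocks have used up the values 1, ..., a. The
  -- bound `1 ≤ v` keeps out the junk index of 0.
  initial-blocks : ∀ μ r a → n ≡ a + sum μ →
    (∀ {v} → v ≤ a → 1 ≤ v → blockIndex ν v < r) →
    (∀ {v} → a < v → blockIndex ν v ≡ r + blockIndex μ (v ∸ a)) →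
    concat (decodeBlocks μ r (initial ν)) ≡ rng a (sum μ) × map length (decodeBlocks μ r (initial ν)) ≡ μ
  initial-blocks [] r a n≡ lo hi = refl , refl
  initial-blocks (k ∷ μ) r a n≡ lo hi =
    trans (cong₂ _++_ word≡ (proj₁ rec)) (sym (rng-++ a k (sum μ))) ,
    cong₂ _∷_ (trans (cong length word≡) (rng-length a k)) (proj₂ rec)
    where
      rng-length : ∀ a k → length (rng a k) ≡ k
      rng-length a zero = refl
      rng-length a (suc k) = cong suc (rng-length (suc a) k)
      mid : ∀ {v} → a < v → v ≤ a + k → blockIndex ν v ≡ r
      mid {v} p q = trans (hi p) (trans (cong (r +_) (blockIndex-yes μ
        (≤-trans (∸-monoˡ-≤ a q) (≤-reflexive (m+n∸m≡n a k))))) (+-identityʳ r))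
      hi′ : ∀ {v} → a + k < v → blockIndex ν v ≡ suc r + blockIndex μ (v ∸ (a + k))
      hi′ {v} p = trans (hi (≤-<-trans (m≤m+n a k) p)) (trans (cong (r +_)
        (trans (blockIndex-no μ (<⇒≱ (m+n≤o⇒m≤o∸n (suc k) (subst (_≤ v) (cong suc (+-comm a k)) p))))
          (cong (λ x → suc (blockIndex μ x)) (∸-+-assoc v a k)))) (+-suc r _))
      rng-split′ : rng 0 n ≡ rng 0 a ++ rng a k ++ rng (a + k) (sum μ)
      rng-split′ = trans (cong (rng 0) n≡) (trans (rng-++ 0 a (k + sum μ)) (cong (rng 0 a ++_) (rng-++ a k (sum μ))))
      word≡ : word (initial ν) r ≡ rng a k
      word≡ = trans (map-id (blk (initial ν) r)) (trans (cong (filter (λ v → blockIndex ν v ≟ r)) rng-split′)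
        (filter-middle (λ v → blockIndex ν v ≟ r) (rng 0 a) (rng a k) (rng (a + k) (sum μ))
          (λ m e → let (p , q) = rng-∈⁻ 0 a m in <-irrefl e (lo q p))
          (λ m → let (p , q) = rng-∈⁻ a k m in mid p q)
          (λ m e → m≢1+m+n r (trans (sym e) (hi′ (proj₁ (rng-∈⁻ (a + k) (sum μ) m)))))))
      lo′ : ∀ {v} → v ≤ a + k → 1 ≤ v → blockIndex ν v < suc r
      lo′ {v} q p with v ≤? a
      ... | yes l = m≤n⇒m≤1+n (lo l p)
      ... | no l = s≤s (≤-reflexive (mid (≰⇒> l) q))
      rec : concat (decodeBlocks μ (suc r) (initial ν)) ≡ rng (a + k) (sum μ) × map length (decodeBlocks μ (suc r) (initial ν)) ≡ μ
      rec = initial-blocks μ (suc r) (a + k) (trans n≡ (sym (+-assoc a k (sum μ)))) lo′ hi′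

  initial-decode : decode ν (initial ν) ≡ idPerm n × map length (decodeBlocks ν 0 (initial ν)) ≡ ν
  initial-decode with initial-blocks ν 0 0 (sym sum-ν) (λ p q → ⊥-elim (<-irrefl refl (≤-trans q p))) (λ _ → refl)
  ... | p , q = trans p (trans (cong (rng 0) sum-ν) (sym (idPerm-rng n))) , q

  Good : State → Set
  Good = Fits ν (initial ν)

  initial-good : Good (initial ν)
  initial-good = record
    { closed = λ _ _ → refl
    ; inside = λ (p , q) → blockIndex-< ν p (subst (_ ≤_) (sym sum-ν) q)
    ; outside = λ _ → refl
    ; sizes = proj₂ initial-decode
    }

  step-good : ∀ {M} i → 1 ≤ i → i < n → Good M → step ν (decode ν M) i ≡ decode ν (U i M) × Good (U i M)
  step-good (suc i) _ h F = step-decode i k n≡ (Fits.closed F) ν F , fits-U i k n≡ (Fits.closed F) F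
    where
      k : ℕ
      -- The letter is i + 1, so i values lie below the pair i + 1, i + 2 and k above it.
      k = n ∸ suc (suc i)
      n≡ : n ≡ i + (2 + k)
      n≡ = trans (sym (m+[n∸m]≡n h)) (sym (trans (+-suc i (suc k)) (cong suc (+-suc i k))))

  run : ∀ a {M} → IsWord n a → Good M →
    foldl (step ν) (decode ν M) a ≡ decode ν (foldl (flip U) M a) × Good (foldl (flip U) M a)
  run = foldl-simulation (step ν) (flip U) (decode ν) Good λ {M} {i} (p , q) → step-good i p q

  E-foldr : ∀ w → E w ≡ foldr U (initial ν) w
  E-foldr [] = refl
  E-foldr (s ∷ w) = cong (U s) (E-foldr w)

  E-reverse : ∀ a → foldl (flip U) (initial ν) a ≡ E (reverse a)
  E-reverse a = sym (trans (E-foldr (reverse a)) (reverse-foldr U (initial ν) a))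

  value : List ℕ → State
  value a = E (reverse a)

  value-good : ∀ {a} → IsWord n a → Good (value a)
  value-good {a} h = subst Good (E-reverse a) (proj₂ (run a h initial-good))

  act-value : ∀ {a} → IsWord n a → act n ν a ≡ decode ν (value a)
  act-value {a} h = trans (cong (λ π → foldl (step ν) π a) (sym (proj₁ initial-decode)))
    (trans (proj₁ (run a h initial-good)) (cong (decode ν) (E-reverse a)))

  act-≈ : ∀ {a b} → IsWord n a → IsWord n b → act n ν a ≡ act n ν b → value a ≈ value b
  act-≈ ha hb eq = decode-injective (value-good ha) (value-good hb)
    (trans (sym (act-value ha)) (trans eq (act-value hb)))

  ≈-act : ∀ {a b} → IsWord n a → IsWord n b → value a ≈ value b → act n ν a ≡ act n ν b
  ≈-act ha hb eq = trans (act-value ha) (trans (decode-cong ν eq) (sym (act-value hb)))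

theorem3p16 : (n : ℕ) (μ : List ℕ) → IsComposition n μ →
    (τ : List ℕ) → IsMuInvolution n μ τ →
    (a : List ℕ) → IsWord n a → (m : Fin (length a)) →
    NearlyMuReduced n μ τ a m →
    ∃ λ (k : Fin (length a)) → k ≢ m × NearlyMuReduced n μ τ a k ×
    (∀ (k′ : Fin (length a)) → k′ ≢ m → NearlyMuReduced n μ τ a k′ → k′ ≡ k)
theorem3p16 n μ (_ , sum-μ) τ _ =
  ReducedWords.unique-other (μ-action (initial μ) (initial-asc μ)) (λ i → 1 ≤ i × i < n) (act n μ)
    (Simulation.act-≈ n μ sum-μ) (Simulation.≈-act n μ sum-μ) τ
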